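{- Let $A$ be a finite alphabet. For every sentence $I$ over $A$, the coloured ribbon non-commutative Schur function $R_I$ in $\mathrm{NSym}_A$ satisfies $$(S\circ r)(R_I)=(-1)^{|I|}R_{I^c}.$$
   Context: $\Bbbk$ is a field of characteristic zero. A sentence $I=(w_1,\dots,w_m)$ over $A$ is a finite sequence of non-empty words in letters of $A$; $1$ is the empty sentence. $|I|$ is the total number of letters; the maximal word of $I$ is $w(I)=w_1\cdots w_m$. $I\cdot J$ is concatenation of sequences of words. Write $J\preccurlyeq I$ ($J$ refines $I$) if the words of $I$ can be obtained by concatenating adjacent words of $J$. The reversal is $I^r=(w_m,\dots,w_1)$. The complement $I^c$ is the sentence with the same maximal word as $I$ in which two consecutive letters of $w(I)$ are separated (belong to different words) if and only if they are not separated in $I$; e.g. $(aba,ca,bac)^c=(a,b,ac,ab,a,c)$. $\mathrm{NSym}_A$ is the Hopf algebra over $\Bbbk$ with linear basis $(H_I)$ indexed by sentences, graded by $|I|$, with product $H_IH_J=H_{I\cdot J}$ and coproduct $\Delta(H_I)=\sum_{J\subset I}H_{\widetilde{I\setminus J}}\otimes H_{\widetilde J}$. Here, for $I=(w_1,\dots,w_m)$, $J=(v_1,\dots,v_m)$ runs over sequences of possibly empty words such that $w_i=u_iv_i$ for some words $u_i$; $I\setminus J=(u_1,\dots,u_m)$; and tilde means deleting the empty words. $S$ is its antipode, and $r$ is the linear map with $r(H_I)=H_{I^r}$. $\mathrm{QSym}_A$ is the graded dual of $\mathrm{NSym}_A$ with basis $(M_I)$ dual to $(H_I)$: $\langle M_I,H_J\rangle=\delta_{I,J}$.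 The fundamental functions $F_I=\sum_{J\preccurlyeq I}M_J$ form a basis of $\mathrm{QSym}_A$, and $(R_I)$ is the basis of $\mathrm{NSym}_A$ dual to it: $\langle F_I,R_J\rangle=\delta_{I,J}$. -}

module Defs where

open import Algebra.Apartness.Bundles using (HeytingField; HeytingCommutativeRing)
open import Algebra.Bundles using (CommutativeRing; Semiring)
import Algebra.Definitions.RawMonoid as RawMonoidDefinitions
import Algebra.Definitions.RawSemiring as RawSemiringDefinitions
open import Algebra.Module.Bundles using (Module)
import Algebra.Module.Construct.TensorUnit as TensorUnit
open import Algebra.Module.Morphism.Structures using (module ModuleMorphisms)
open import Algebra.Module.Structures.Biased using (IsModuleFromLeft)
import Algebra.Properties.Ring as RingProperties
open import Data.Bool.Base using (Bool; true; false; not; if_then_else_)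
open import Data.Fin.Base using (Fin)
open import Data.Fin.Properties using (inj⇒≟)
open import Data.List.Base as List
  using (List; []; _∷_; _++_; map; concat; mapMaybe; foldr; reverse; length; replicate; cartesianProductWith)
open import Data.List.Membership.Propositional using (_∈_)
open import Data.List.Membership.Propositional.Properties
  using (∈-map⁺; ∈-map⁻; ∈-++⁺ˡ; ∈-++⁺ʳ; ∈-++⁻; ∈-cartesianProductWith⁺; ∈-cartesianProductWith⁻)
open import Data.List.NonEmpty.Base as List⁺ using (List⁺; _∷_; toList; fromList)
import Data.List.Properties as Listₚ
open import Data.List.Relation.Binary.Pointwise.Base using (Pointwise; []; _∷_)
open import Data.List.Relation.Unary.All using ([])
open import Data.List.Relation.Unary.AllPairs using ([]; _∷_)
open import Data.List.Relation.Unary.Any using (here; there)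
open import Data.List.Relation.Unary.Unique.Propositional using (Unique)
import Data.List.Relation.Unary.Unique.Propositional.Properties as Uniqueₚ
open import Data.Nat.Base as ℕᵇ using (ℕ; suc)
import Data.Nat.Properties as ℕₚ
open import Data.Product.Base using (_×_; _,_; proj₁; proj₂; map₁; ∃; ∃₂)
import Data.Product.Properties as Productₚ
open import Data.Sum.Base using (inj₁; inj₂)
open import Function.Base using (id; _∘_)
open import Function.Bundles using (_↔_; _⇔_; mk⇔)
open import Function.Properties.Inverse using (Inverse⇒Injection)
open import Level using (Level; _⊔_)
open import Relation.Binary.Definitions using (DecidableEquality)
open import Relation.Binary.PropositionalEquality as ≡ using (_≡_)
open import Relation.Nullary.Decidable using (does; map′)
open import Relation.Nullary.Negation using (¬_)

module Sentences {a : Level} (A : Set a) where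

  Word : Set a
  Word = List A

  Sentence : Set a
  Sentence = List (List⁺ A)

  maximalWord : Sentence → Word
  maximalWord I = concat (map toList I)

  ∣_∣ : Sentence → ℕ
  ∣ I ∣ = length (maximalWord I)

  tilde : List Word → Sentence
  tilde = mapMaybe fromList

  -- Each word of I is the concatenation of one block of adjacent words of J.

  _≼_ : Sentence → Sentence → Set a
  J ≼ I = ∃ λ (blocks : List (List⁺ (List⁺ A))) →
    (J ≡ concat (map toList blocks)) × (I ≡ map List⁺.concat blocks)

  infixr 5 _◂_

  _◂_ : A → Sentence → Sentence
  x ◂ []      = (x ∷ []) ∷ []
  x ◂ (w ∷ I) = (x List⁺.∷⁺ w) ∷ I

  -- A sentence is determined by its maximal word and its separations.
  -- One Boolean for each pair of consecutive letters of the maximal word: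
  -- true if the two letters belong to different words.

  separations : Sentence → List Bool
  separations []                    = []
  separations ((x ∷ w) ∷ [])        = replicate (length w) false
  separations ((x ∷ w) ∷ I@(_ ∷ _)) = replicate (length w) false ++ true ∷ separations I

  -- The sentence with given maximal word and given separations.  The list of
  -- Booleans is meant to be one shorter than the word; missing entries count
  -- as false.

  cut : Word → List Bool → Sentence
  cut []          _           = []
  cut (x ∷ [])    _           = (x ∷ []) ∷ []
  cut (x ∷ y ∷ w) []          = x ◂ cut (y ∷ w) []
  cut (x ∷ y ∷ w) (true  ∷ s) = (x ∷ []) ∷ cut (y ∷ w) s
  cut (x ∷ y ∷ w) (false ∷ s) = x ◂ cut (y ∷ w) s

  infix 9 _ᶜ

  -- See maximalWord-ᶜ and separations-ᶜ below.

  _ᶜ : Sentence → Sentence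
  I ᶜ = cut (maximalWord I) (map not (separations I))

  -- refinements I lists each J ≼ I exactly once: see ∈-refinements and
  -- Unique-refinements below.

  refineWord : A → List A → List Sentence → List Sentence
  refineWord x []      Js = map ((x ∷ []) ∷_) Js
  refineWord x (y ∷ w) Js = map ((x ∷ []) ∷_) Ks ++ map (x ◂_) Ks
    where
    Ks : List Sentence
    Ks = refineWord y w Js

  refinements : Sentence → List Sentence
  refinements []            = [] ∷ []
  refinements ((x ∷ w) ∷ I) = refineWord x w (refinements I)

  factorisations : Word → List (Word × Word)
  factorisations []      = ([] , []) ∷ []
  factorisations (x ∷ w) = ([] , x ∷ w) ∷ map (map₁ (x ∷_)) (factorisations w)

  -- The sequences J ⊂ I of final factors, each word vᵢ of J being paired with
  -- the word uᵢ of I ∖ J that it determines; see ∈-splittings and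
  -- Unique-splittings below.

  splittings : Sentence → List (List (Word × Word))
  splittings []      = [] ∷ []
  splittings (w ∷ I) = cartesianProductWith _∷_ (factorisations (toList w)) (splittings I)

module SentenceProperties {a : Level} {A : Set a} where

  open Sentences A

  private

    concat-◂ : ∀ x I → maximalWord (x ◂ I) ≡ x ∷ maximalWord I
    concat-◂ x []      = ≡.refl
    concat-◂ x (w ∷ I) = ≡.refl

    maximalWord-cut : ∀ w s → maximalWord (cut w s) ≡ w
    maximalWord-cut []          _           = ≡.refl
    maximalWord-cut (x ∷ [])    _           = ≡.refl
    maximalWord-cut (x ∷ y ∷ w) []          =
      ≡.trans (concat-◂ x (cut (y ∷ w) [])) (≡.cong (x ∷_) (maximalWord-cut (y ∷ w) []))
    maximalWord-cut (x ∷ y ∷ w) (true  ∷ s) = ≡.cong (x ∷_) (maximalWord-cut (y ∷ w) s)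
    maximalWord-cut (x ∷ y ∷ w) (false ∷ s) =
      ≡.trans (concat-◂ x (cut (y ∷ w) s)) (≡.cong (x ∷_) (maximalWord-cut (y ∷ w) s))

    cut-nonEmpty : ∀ x w s → ∃₂ λ v I → cut (x ∷ w) s ≡ v ∷ I
    cut-nonEmpty x []      s           = _ , _ , ≡.refl
    cut-nonEmpty x (y ∷ w) []          with cut (y ∷ w) []
    ... | []    = _ , _ , ≡.refl
    ... | _ ∷ _ = _ , _ , ≡.refl
    cut-nonEmpty x (y ∷ w) (true  ∷ s) = _ , _ , ≡.refl
    cut-nonEmpty x (y ∷ w) (false ∷ s) with cut (y ∷ w) s
    ... | []    = _ , _ , ≡.refl
    ... | _ ∷ _ = _ , _ , ≡.refl

    separations-◂ : ∀ x v I → separations (x ◂ (v ∷ I)) ≡ false ∷ separations (v ∷ I)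
    separations-◂ x v []      = ≡.refl
    separations-◂ x v (_ ∷ _) = ≡.refl

    separations-cut : ∀ x w s → length s ≡ length w → separations (cut (x ∷ w) s) ≡ s
    separations-cut x []      []          _  = ≡.refl
    separations-cut x (y ∷ w) (true  ∷ s) eq
      with cut (y ∷ w) s | cut-nonEmpty y w s | separations-cut y w s (ℕₚ.suc-injective eq)
    ... | _ | _ , _ , ≡.refl | ih = ≡.cong (true ∷_) ih
    separations-cut x (y ∷ w) (false ∷ s) eq
      with cut (y ∷ w) s | cut-nonEmpty y w s | separations-cut y w s (ℕₚ.suc-injective eq)
    ... | _ | v , I , ≡.refl | ih = ≡.trans (separations-◂ x v I) (≡.cong (false ∷_) ih)

    length-separations : ∀ x w I →
      length (separations ((x ∷ w) ∷ I)) ≡ length (w ++ maximalWord I)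
    length-separations x w [] =
      ≡.trans (Listₚ.length-replicate (length w)) (≡.cong length (≡.sym (Listₚ.++-identityʳ w)))
    length-separations x w I@((y ∷ v) ∷ I′) = begin
      length (replicate (length w) false ++ true ∷ separations I)
        ≡⟨ Listₚ.length-++ (replicate (length w) false) ⟩
      length (replicate (length w) false) ℕᵇ.+ suc (length (separations I))
        ≡⟨ ≡.cong₂ (λ m n → m ℕᵇ.+ suc n) (Listₚ.length-replicate (length w)) (length-separations y v I′) ⟩
      length w ℕᵇ.+ length (maximalWord I)
        ≡⟨ Listₚ.length-++ w ⟨
      length (w ++ maximalWord I) ∎
      where
      open ≡.≡-Reasoning

  maximalWord-ᶜ : ∀ I → maximalWord (I ᶜ) ≡ maximalWord I
  maximalWord-ᶜ I = maximalWord-cut (maximalWord I) (map not (separations I))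

  separations-ᶜ : ∀ I → separations (I ᶜ) ≡ map not (separations I)
  separations-ᶜ []            = ≡.refl
  separations-ᶜ ((x ∷ w) ∷ I) = separations-cut x (w ++ maximalWord I) _
    (≡.trans (Listₚ.length-map not (separations ((x ∷ w) ∷ I))) (length-separations x w I))

  private

    Refine : A → List A → List Sentence → Sentence → Set a
    Refine x w Js J = ∃₂ λ (K : List⁺ (List⁺ A)) J′ →
      J′ ∈ Js × (J ≡ toList K ++ J′) × (maximalWord (toList K) ≡ x ∷ w)

    ∈-refineWord⁻ : ∀ x w Js {J} → J ∈ refineWord x w Js → Refine x w Js J
    ∈-refineWord⁻ x [] Js p with ∈-map⁻ _ p
    ... | J′ , J′∈ , ≡.refl = (x ∷ []) ∷ [] , J′ , J′∈ , ≡.refl , ≡.refl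
    ∈-refineWord⁻ x (y ∷ w) Js p with ∈-++⁻ (map ((x ∷ []) ∷_) (refineWord y w Js)) p
    ... | inj₁ q with ∈-map⁻ _ q
    ...   | _ , K∈ , ≡.refl with ∈-refineWord⁻ y w Js K∈
    ...     | k ∷ K , J′ , J′∈ , ≡.refl , eq =
      (x ∷ []) ∷ k ∷ K , J′ , J′∈ , ≡.refl , ≡.cong (x ∷_) eq
    ∈-refineWord⁻ x (y ∷ w) Js p | inj₂ q with ∈-map⁻ _ q
    ...   | _ , K∈ , ≡.refl with ∈-refineWord⁻ y w Js K∈
    ...     | k ∷ K , J′ , J′∈ , ≡.refl , eq =
      (x List⁺.∷⁺ k) ∷ K , J′ , J′∈ , ≡.refl , ≡.cong (x ∷_) eq

    ∈-refineWord⁺ : ∀ x w Js {J} → Refine x w Js J → J ∈ refineWord x w Js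
    ∈-refineWord⁺ x []      Js ((_ ∷ []) ∷ [] , J′ , J′∈ , ≡.refl , ≡.refl) = ∈-map⁺ _ J′∈
    ∈-refineWord⁺ x (y ∷ w) Js ((_ ∷ []) ∷ k ∷ K , J′ , J′∈ , ≡.refl , eq)
      with Listₚ.∷-injective eq
    ... | ≡.refl , eq′ =
      ∈-++⁺ˡ (∈-map⁺ _ (∈-refineWord⁺ y w Js (k ∷ K , J′ , J′∈ , ≡.refl , eq′)))
    ∈-refineWord⁺ x (y ∷ w) Js ((_ ∷ z ∷ k) ∷ K , J′ , J′∈ , ≡.refl , eq)
      with Listₚ.∷-injective eq
    ... | ≡.refl , eq′ = ∈-++⁺ʳ (map ((x ∷ []) ∷_) (refineWord y w Js))
      (∈-map⁺ (x ◂_) (∈-refineWord⁺ y w Js ((z ∷ k) ∷ K , J′ , J′∈ , ≡.refl , eq′)))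

    ◂-injective : ∀ {x} {I J} → x ◂ I ≡ x ◂ J → I ≡ J
    ◂-injective {I = []}    {[]}    _      = ≡.refl
    ◂-injective {I = _ ∷ _} {_ ∷ _} ≡.refl = ≡.refl

    Unique-refineWord : ∀ x w {Js} → Unique Js → Unique (refineWord x w Js)
    Unique-refineWord x []      u = Uniqueₚ.map⁺ Listₚ.∷-injectiveʳ u
    Unique-refineWord x (y ∷ w) {Js} u =
      Uniqueₚ.++⁺ (Uniqueₚ.map⁺ Listₚ.∷-injectiveʳ ih) (Uniqueₚ.map⁺ ◂-injective ih) disjoint
      where
      ih : Unique (refineWord y w Js)
      ih = Unique-refineWord y w u

      disjoint : ∀ {J} → ¬ (J ∈ map ((x ∷ []) ∷_) (refineWord y w Js) ×
                            J ∈ map (x ◂_) (refineWord y w Js))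
      disjoint (p , q) with ∈-map⁻ _ p | ∈-map⁻ _ q
      ... | _ , _ , ≡.refl | _ , K∈ , eq with ∈-refineWord⁻ y w Js K∈
      disjoint (p , q) | _ , _ , ≡.refl | _ , K∈ , () | _ ∷ _ , _ , _ , ≡.refl , _

    refinements-sound : ∀ I {J} → J ∈ refinements I → J ≼ I
    refinements-sound []            (here ≡.refl) = [] , ≡.refl , ≡.refl
    refinements-sound ((x ∷ w) ∷ I) p with ∈-refineWord⁻ x w (refinements I) p
    ... | k ∷ K , J′ , J′∈ , ≡.refl , ≡.refl with refinements-sound I J′∈
    ...   | blocks , ≡.refl , ≡.refl = (k ∷ K) ∷ blocks , ≡.refl , ≡.refl

    refinements-complete : ∀ blocks →
      concat (map toList blocks) ∈ refinements (map List⁺.concat blocks)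
    refinements-complete []           = here ≡.refl
    refinements-complete (K ∷ blocks) = ∈-refineWord⁺ _ _ _
      (K , _ , refinements-complete blocks , ≡.refl , ≡.refl)

  ∈-refinements : ∀ I J → J ∈ refinements I ⇔ J ≼ I
  ∈-refinements I J = mk⇔ (refinements-sound I)
    λ { (blocks , ≡.refl , ≡.refl) → refinements-complete blocks }

  Unique-refinements : ∀ I → Unique (refinements I)
  Unique-refinements []            = [] ∷ []
  Unique-refinements ((x ∷ w) ∷ I) = Unique-refineWord x w (Unique-refinements I)

  private

    factorisations-sound : ∀ w {u v} → (u , v) ∈ factorisations w → u ++ v ≡ w
    factorisations-sound []      (here ≡.refl) = ≡.refl
    factorisations-sound (x ∷ w) (here ≡.refl) = ≡.refl
    factorisations-sound (x ∷ w) (there p) with ∈-map⁻ _ p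
    ... | _ , q , ≡.refl = ≡.cong (x ∷_) (factorisations-sound w q)

    factorisations-complete : ∀ u v → (u , v) ∈ factorisations (u ++ v)
    factorisations-complete []      []      = here ≡.refl
    factorisations-complete []      (_ ∷ _) = here ≡.refl
    factorisations-complete (x ∷ u) v       = there (∈-map⁺ _ (factorisations-complete u v))

    Unique-factorisations : ∀ w → Unique (factorisations w)
    Unique-factorisations []      = [] ∷ []
    Unique-factorisations (x ∷ w) =
      Uniqueₚ.++⁺ {xs = ([] , x ∷ w) ∷ []} ([] ∷ [])
        (Uniqueₚ.map⁺ (λ { ≡.refl → ≡.refl }) (Unique-factorisations w))
        λ { (here ≡.refl , q) → absurd (∈-map⁻ _ q) }
      where
      absurd : ¬ (∃ λ uv → uv ∈ factorisations w × ([] , x ∷ w) ≡ map₁ (x ∷_) uv)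
      absurd (_ , _ , ())

  IsSplitting : List (Word × Word) → Sentence → Set a
  IsSplitting = Pointwise (λ uv w → proj₁ uv ++ proj₂ uv ≡ toList w)

  ∈-splittings : ∀ I P → P ∈ splittings I ⇔ IsSplitting P I
  ∈-splittings I P = mk⇔ (sound I) complete
    where
    sound : ∀ I {P} → P ∈ splittings I → IsSplitting P I
    sound []      (here ≡.refl) = []
    sound (w ∷ I) p with ∈-cartesianProductWith⁻ _∷_ (factorisations (toList w)) (splittings I) p
    ... | _ , _ , uv∈ , P∈ , ≡.refl = factorisations-sound (toList w) uv∈ ∷ sound I P∈

    complete : ∀ {P I} → IsSplitting P I → P ∈ splittings I
    complete []       = here ≡.refl
    complete {(u , v) ∷ _} (eq ∷ ps) = ∈-cartesianProductWith⁺ _∷_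
      (≡.subst (λ w → (u , v) ∈ factorisations w) eq (factorisations-complete u v))
      (complete ps)

  Unique-splittings : ∀ I → Unique (splittings I)
  Unique-splittings []      = [] ∷ []
  Unique-splittings (w ∷ I) = Uniqueₚ.cartesianProductWith⁺ _∷_ Listₚ.∷-injective
    (Unique-factorisations (toList w)) (Unique-splittings I)

module FreeModules {c ℓ : Level} (K : CommutativeRing c ℓ) where

  open CommutativeRing K

  ground : Module K c ℓ
  ground = TensorUnit.⟨module⟩

  -- Formal linear combinations of elements of B.

  Combination : {b : Level} → Set b → Set (c ⊔ b)
  Combination B = List (Carrier × B)

  basis : {b : Level} {B : Set b} → B → Combination B
  basis x = (1# , x) ∷ []

  infixr 7 _·_

  _·_ : {b : Level} {B : Set b} → Carrier → Combination B → Combination B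
  k · x = map (map₁ (k *_)) x

  infixr 7 _⊗_

  _⊗_ : {b d : Level} {B : Set b} {D : Set d} → Combination B → Combination D → Combination (B × D)
  _⊗_ = cartesianProductWith λ { (k , x) (l , y) → (k * l , (x , y)) }

  module _ {m ℓm b : Level} (M : Module K m ℓm) {B : Set b} where

    open Module M

    -- The linear extension of a map defined on the basis.

    extend : (B → Carrierᴹ) → Combination B → Carrierᴹ
    extend f []            = 0ᴹ
    extend f ((k , x) ∷ v) = k *ₗ f x +ᴹ extend f v

    ∑ : List B → (B → Carrierᴹ) → Carrierᴹ
    ∑ xs f = foldr (λ x v → f x +ᴹ v) 0ᴹ xs

  module _ {b : Level} {B : Set b} (_≟_ : DecidableEquality B) where

    δ : B → B → Carrier
    δ x y = if does (x ≟ y) then 1# else 0#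

    -- Two combinations represent the same element of the free module when all
    -- their coefficients agree.

    coefficient : B → Combination B → Carrier
    coefficient x = extend ground (δ x)

    infix 4 _≋_

    _≋_ : Combination B → Combination B → Set (b ⊔ ℓ)
    v ≋ w = ∀ x → coefficient x v ≈ coefficient x w

    private

      coefficient-++ : ∀ x v w → coefficient x (v ++ w) ≈ coefficient x v + coefficient x w
      coefficient-++ x []            w = sym (+-identityˡ _)
      coefficient-++ x ((k , y) ∷ v) w =
        trans (+-congˡ (coefficient-++ x v w)) (sym (+-assoc _ _ _))

      coefficient-· : ∀ x k v → coefficient x (k · v) ≈ k * coefficient x v
      coefficient-· x k []            = sym (zeroʳ k)
      coefficient-· x k ((l , y) ∷ v) =
        trans (+-cong (*-assoc k l _) (coefficient-· x k v)) (sym (distribˡ k _ _))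

      negate-inverse : ∀ v → (- 1# · v) ++ v ≋ []
      negate-inverse v x = trans (coefficient-++ x (- 1# · v) v)
        (trans (+-congʳ (trans (coefficient-· x (- 1#) v) (RingProperties.-1*x≈-x ring _)))
          (-‿inverseˡ _))

      +-swap : ∀ v w → v ++ w ≋ w ++ v
      +-swap v w x = trans (coefficient-++ x v w)
        (trans (+-comm _ _) (sym (coefficient-++ x w v)))

    free : Module K (c ⊔ b) (b ⊔ ℓ)
    free = record
      { Carrierᴹ = Combination B
      ; _≈ᴹ_     = _≋_
      ; _+ᴹ_     = _++_
      ; _*ₗ_     = _·_
      ; _*ᵣ_     = λ v k → k · v
      ; 0ᴹ       = []
      ; -ᴹ_      = - 1# ·_
      ; isModule = IsModuleFromLeft.isModule {commutativeRing = K} (record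
        { isLeftModule = record
          { isLeftSemimodule = record
            { +ᴹ-isCommutativeMonoid = record
              { isMonoid = record
                { isSemigroup = record
                  { isMagma = record
                    { isEquivalence = record
                      { refl  = λ _ → refl
                      ; sym   = λ p x → sym (p x)
                      ; trans = λ p q x → trans (p x) (q x)
                      }
                    ; ∙-cong = λ {v} {v′} {w} {w′} p q x → trans (coefficient-++ x v w)
                        (trans (+-cong (p x) (q x)) (sym (coefficient-++ x v′ w′)))
                    }
                  ; assoc = λ u v w x → reflexive (≡.cong (coefficient x) (Listₚ.++-assoc u v w))
                  }
                ; identity = (λ _ _ → refl)
                           , (λ v x → reflexive (≡.cong (coefficient x) (Listₚ.++-identityʳ v)))
                }
              ; comm = +-swap
              }
            ; isPreleftSemimodule = record
              { *ₗ-cong = λ {k} {k′} {v} {v′} p q x → trans (coefficient-· x k v)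
                  (trans (*-cong p (q x)) (sym (coefficient-· x k′ v′)))
              ; *ₗ-zeroˡ = λ v x → trans (coefficient-· x 0# v) (zeroˡ _)
              ; *ₗ-distribʳ = λ v k l x → trans (coefficient-· x (k + l) v)
                  (trans (distribʳ _ k l)
                    (trans (+-cong (sym (coefficient-· x k v)) (sym (coefficient-· x l v)))
                      (sym (coefficient-++ x (k · v) (l · v)))))
              ; *ₗ-identityˡ = λ v x → trans (coefficient-· x 1# v) (*-identityˡ _)
              ; *ₗ-assoc = λ k l v x → trans (coefficient-· x (k * l) v)
                  (trans (*-assoc k l _)
                    (trans (*-congˡ (sym (coefficient-· x l v))) (sym (coefficient-· x k (l · v)))))
              ; *ₗ-zeroʳ = λ _ _ → refl
              ; *ₗ-distribˡ = λ k v w x →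
                  reflexive (≡.cong (coefficient x) (Listₚ.map-++ (map₁ (k *_)) v w))
              }
            }
          ; -ᴹ‿cong = λ {v} {w} p x → trans (coefficient-· x (- 1#) v)
              (trans (*-congˡ (p x)) (sym (coefficient-· x (- 1#) w)))
          ; -ᴹ‿inverse = negate-inverse
                       , (λ v x → trans (+-swap v (- 1# · v) x) (negate-inverse v x))
          }
        })
      }

module Field {c ℓ₁ ℓ₂ : Level} (𝕜 : HeytingField c ℓ₁ ℓ₂) where

  ring : CommutativeRing c ℓ₁
  ring = HeytingCommutativeRing.commutativeRing (HeytingField.heytingCommutativeRing 𝕜)

  open CommutativeRing ring using (Carrier; _≈_; 0#; 1#; -_; +-rawMonoid; semiring)

  -- Heyting fields generalise discrete ones; classically every field, with the
  -- apartness relation x ≉ y, is one.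

  CharacteristicZero : Set ℓ₁
  CharacteristicZero = ∀ n → ¬ (suc n ×ₙ 1# ≈ 0#)
    where open RawMonoidDefinitions +-rawMonoid renaming (_×_ to _×ₙ_)

  sign : ℕ → Carrier
  sign n = (- 1#) ^ n
    where open RawSemiringDefinitions (Semiring.rawSemiring semiring) using (_^_)

module Symmetric {c ℓ₁ ℓ₂ a : Level} (𝕜 : HeytingField c ℓ₁ ℓ₂)
                 {A : Set a} {n : ℕ} (finite : A ↔ Fin n) where

  open Field 𝕜 public
  open CommutativeRing ring using (Carrier; _≈_)
  open Sentences A public
  open FreeModules ring public

  infix 4 _≟_

  _≟_ : DecidableEquality Sentence
  _≟_ = Listₚ.≡-dec (λ { (x ∷ v) (y ∷ w) →
    map′ (λ { ≡.refl → ≡.refl }) (λ { ≡.refl → ≡.refl }) (Listₚ.≡-dec _≟ᴬ_ (x ∷ v) (y ∷ w)) })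
    where
    _≟ᴬ_ : DecidableEquality A
    _≟ᴬ_ = inj⇒≟ (Inverse⇒Injection finite)

  NSym : Module ring (c ⊔ a) (a ⊔ ℓ₁)
  NSym = free _≟_

  NSym⊗NSym : Module ring (c ⊔ a) (a ⊔ ℓ₁)
  NSym⊗NSym = free (Productₚ.≡-dec _≟_ _≟_)

  -- The graded dual of NSym: its homogeneous components are of finite
  -- dimension, so it is spanned by the basis dual to (H I).

  QSym : Module ring (c ⊔ a) (a ⊔ ℓ₁)
  QSym = free _≟_

  open Module NSym public using (_≈ᴹ_; _*ₗ_) renaming (Carrierᴹ to ∣NSym∣)
  open Module NSym⊗NSym public using () renaming (Carrierᴹ to ∣NSym⊗NSym∣)
  open Module QSym public using () renaming (Carrierᴹ to ∣QSym∣)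

  H : Sentence → ∣NSym∣
  H = basis

  μ : ∣NSym⊗NSym∣ → ∣NSym∣
  μ = extend NSym λ { (I , J) → H (I ++ J) }

  η : Carrier → ∣NSym∣
  η k = k *ₗ H []

  Δ : ∣NSym∣ → ∣NSym⊗NSym∣
  Δ = extend NSym⊗NSym λ I → ∑ NSym⊗NSym (splittings I) λ P →
    H (tilde (map proj₁ P)) ⊗ H (tilde (map proj₂ P))

  ε : ∣NSym∣ → Carrier
  ε = coefficient _≟_ []

  -- The tensor product of linear maps.

  _⊗ₗ_ : (∣NSym∣ → ∣NSym∣) → (∣NSym∣ → ∣NSym∣) → ∣NSym⊗NSym∣ → ∣NSym⊗NSym∣
  f ⊗ₗ g = extend NSym⊗NSym λ { (I , J) → f (H I) ⊗ g (H J) }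

  record IsAntipode (S : ∣NSym∣ → ∣NSym∣) : Set (c ⊔ a ⊔ ℓ₁) where
    open ModuleMorphisms (Module.rawModule NSym) (Module.rawModule NSym)
    field
      linear   : IsModuleHomomorphism S
      inverseˡ : ∀ x → μ ((S ⊗ₗ id) (Δ x)) ≈ᴹ η (ε x)
      inverseʳ : ∀ x → μ ((id ⊗ₗ S) (Δ x)) ≈ᴹ η (ε x)

  r : ∣NSym∣ → ∣NSym∣
  r = extend NSym (H ∘ reverse)

  M : Sentence → ∣QSym∣
  M = basis

  -- The bilinear pairing with ⟨ M I , H J ⟩ ≈ δ I J.

  ⟨_,_⟩ : ∣QSym∣ → ∣NSym∣ → Carrier
  ⟨ f , x ⟩ = extend ground (λ I → extend ground (δ _≟_ I) x) f

  F : Sentence → ∣QSym∣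
  F I = ∑ QSym (refinements I) M

  -- F being a basis, this determines R I up to ≈ᴹ.

  IsDualToF : (Sentence → ∣NSym∣) → Set (a ⊔ ℓ₁)
  IsDualToF R = ∀ I J → ⟨ F I , R J ⟩ ≈ δ _≟_ I J

{-# OPTIONS --safe #-}

-- Put Φ I = Σ_{J ≼ I} (-1)^(number of words of J) H J.  Then S (r (H I)) = Φ I:
-- the identity Σ H_{I∖J} S (H J) = 0 for I ≠ 1 determines S (H I) by induction on
-- ∣ I ∣, the term with J = I being S (H I) itself, and Φ (reverse I) satisfies it
-- because Σ_{uv = w} H_u Φ_v = 0 for every non-empty word w.
--
-- Since the F J separate the elements of NSym, it then suffices that
-- ⟨ F J , Φ I ⟩ = (-1)^∣ J ∣ ⟨ F (J ᶜ) , H I ⟩, which neither involves R nor needs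
-- Möbius inversion.  Both sides obey the same recursion on the first letters of J
-- and I: if J and I both join the first letter x to the next word, the two ways of
-- refining I at x cancel, and J ᶜ separates x, so that both sides vanish.

module Submission where

open import Defs
open import Level using (Level)
open import Data.Nat.Base using (ℕ; suc; z≤n; s≤s; _≤_; _<_)
open import Data.Fin.Base using (Fin)
open import Function.Bundles using (_↔_; module Equivalence)
open import Algebra.Apartness.Bundles using (HeytingField)

open import Algebra.Bundles using (CommutativeMonoid; CommutativeRing)
open import Algebra.Module.Bundles using (Module)
open import Algebra.Module.Morphism.Structures using (module ModuleMorphisms)
import Algebra.Properties.CommutativeSemigroup as CommutativeSemigroupProperties
import Algebra.Properties.Group as GroupProperties
import Algebra.Properties.Ring as RingProperties
open import Data.List.Base
  using (List; []; _∷_; _++_; _ʳ++_; map; concat; filter; length; reverse; cartesianProductWith)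
open import Data.List.Membership.Propositional using (_∈_)
open import Data.List.Membership.Propositional.Properties
  using (∈-map⁻; ∈-++⁻; ∈-++⁺ʳ; ∈-cartesianProductWith⁻)
open import Data.List.NonEmpty.Base as List⁺ using (_∷_; toList)
open import Data.List.Properties using (filter-notAll; length-++; ++-assoc; reverse-involutive; ∷-injectiveʳ)
open import Data.List.Relation.Binary.Pointwise.Base using ([]; _∷_)
open import Data.List.Relation.Unary.Any using (here; there)
import Data.Nat.Properties as ℕₚ
open import Data.Product.Base using (_×_; _,_; proj₁; proj₂; map₁; ∃₂)
open import Data.Product.Properties using (≡-dec)
open import Data.Sum.Base using ([_,_]′)
open import Function.Base using (_∘_; id)
open import Relation.Binary.Definitions using (DecidableEquality)
open import Relation.Binary.PropositionalEquality as ≡ using (_≡_)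
import Relation.Binary.Reasoning.Setoid as ≈-Reasoning
open import Relation.Nullary.Decidable using (yes; no; ¬?)
open import Relation.Nullary.Negation using (¬_; contradiction)

-- Finite sums, linear extensions and Kronecker deltas over a free module.

module LinearAlgebra {c ℓ : Level} (K : CommutativeRing c ℓ) where

  open CommutativeRing K hiding (zero)
  open FreeModules K

  IsLinear : {m₁ ℓm₁ m₂ ℓm₂ : Level} (N : Module K m₁ ℓm₁) (M : Module K m₂ ℓm₂) →
             (Module.Carrierᴹ N → Module.Carrierᴹ M) → Set _
  IsLinear N M = ModuleMorphisms.IsModuleHomomorphism (Module.rawModule N) (Module.rawModule M)

  module Homomorphism {m₁ ℓm₁ m₂ ℓm₂ : Level} (N : Module K m₁ ℓm₁) (M : Module K m₂ ℓm₂)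
           {φ : Module.Carrierᴹ N → Module.Carrierᴹ M} (φ-linear : IsLinear N M φ) where

    open ModuleMorphisms.IsModuleHomomorphism φ-linear public
    open Module M

    extend-homo : {b : Level} {B : Set b} (f : B → Module.Carrierᴹ N) (v : Combination B) →
                  φ (extend N f v) ≈ᴹ extend M (φ ∘ f) v
    extend-homo f []            = 0ᴹ-homo
    extend-homo f ((k , x) ∷ v) =
      ≈ᴹ-trans (+ᴹ-homo _ _) (+ᴹ-cong (*ₗ-homo k (f x)) (extend-homo f v))

    ∑-homo : {b : Level} {B : Set b} (xs : List B) (f : B → Module.Carrierᴹ N) →
             φ (∑ N xs f) ≈ᴹ ∑ M xs (φ ∘ f)
    ∑-homo []       f = 0ᴹ-homo
    ∑-homo (x ∷ xs) f = ≈ᴹ-trans (+ᴹ-homo _ _) (+ᴹ-congˡ (∑-homo xs f))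

  module _ {m ℓm : Level} (M : Module K m ℓm) where

    open Module M
    open CommutativeSemigroupProperties (CommutativeMonoid.commutativeSemigroup +ᴹ-commutativeMonoid) using (interchange)

    scale-linear : ∀ k → IsLinear M M (k *ₗ_)
    scale-linear k = record { isBimoduleHomomorphism = record
      { +ᴹ-isGroupHomomorphism = record
        { isMonoidHomomorphism = record
          { isMagmaHomomorphism = record
            { isRelHomomorphism = record { cong = *ₗ-congˡ }
            ; homo = *ₗ-distribˡ k
            }
          ; ε-homo = *ₗ-zeroʳ k
          }
        ; ⁻¹-homo = λ x → uniqueʳ‿-ᴹ (k *ₗ x) _ (≈ᴹ-trans (≈ᴹ-sym (*ₗ-distribˡ k x _))
                            (≈ᴹ-trans (*ₗ-congˡ (-ᴹ‿inverseʳ x)) (*ₗ-zeroʳ k)))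
        }
      ; *ₗ-homo = *ₗ-comm k
      ; *ᵣ-homo = λ l x → ≈ᴹ-sym (*ₗ-*ᵣ-assoc k x l)
      } }

    module _ {b : Level} {B : Set b} where

      ∑-cong-∈ : ∀ xs {f g : B → Carrierᴹ} → (∀ {x} → x ∈ xs → f x ≈ᴹ g x) → ∑ M xs f ≈ᴹ ∑ M xs g
      ∑-cong-∈ []       f≈g = ≈ᴹ-refl
      ∑-cong-∈ (x ∷ xs) f≈g = +ᴹ-cong (f≈g (here ≡.refl)) (∑-cong-∈ xs (f≈g ∘ there))

      ∑-cong : ∀ xs {f g : B → Carrierᴹ} → (∀ x → f x ≈ᴹ g x) → ∑ M xs f ≈ᴹ ∑ M xs g
      ∑-cong xs f≈g = ∑-cong-∈ xs (λ {x} _ → f≈g x)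

      ∑-zero : ∀ (xs : List B) → ∑ M xs (λ _ → 0ᴹ) ≈ᴹ 0ᴹ
      ∑-zero []       = ≈ᴹ-refl
      ∑-zero (x ∷ xs) = ≈ᴹ-trans (+ᴹ-identityˡ _) (∑-zero xs)

      ∑-vanish : ∀ xs {f : B → Carrierᴹ} → (∀ {x} → x ∈ xs → f x ≈ᴹ 0ᴹ) → ∑ M xs f ≈ᴹ 0ᴹ
      ∑-vanish xs f≈0 = ≈ᴹ-trans (∑-cong-∈ xs f≈0) (∑-zero xs)

      ∑-++ : ∀ xs ys (f : B → Carrierᴹ) → ∑ M (xs ++ ys) f ≈ᴹ ∑ M xs f +ᴹ ∑ M ys f
      ∑-++ []       ys f = ≈ᴹ-sym (+ᴹ-identityˡ _)
      ∑-++ (x ∷ xs) ys f = ≈ᴹ-trans (+ᴹ-congˡ (∑-++ xs ys f)) (≈ᴹ-sym (+ᴹ-assoc _ _ _))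

      ∑-map : ∀ {d} {D : Set d} (h : D → B) xs (f : B → Carrierᴹ) → ∑ M (map h xs) f ≈ᴹ ∑ M xs (f ∘ h)
      ∑-map h []       f = ≈ᴹ-refl
      ∑-map h (x ∷ xs) f = +ᴹ-congˡ (∑-map h xs f)

      ∑-cartesianProductWith : ∀ {d e} {D : Set d} {E : Set e} (h : D → E → B) xs ys (f : B → Carrierᴹ) →
        ∑ M (cartesianProductWith h xs ys) f ≈ᴹ ∑ M xs (λ x → ∑ M ys (λ y → f (h x y)))
      ∑-cartesianProductWith h []       ys f = ≈ᴹ-refl
      ∑-cartesianProductWith h (x ∷ xs) ys f = ≈ᴹ-trans (∑-++ (map (h x) ys) _ f)
        (+ᴹ-cong (∑-map (h x) ys f) (∑-cartesianProductWith h xs ys f))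

      extend-congᶠ : ∀ {f g : B → Carrierᴹ} → (∀ x → f x ≈ᴹ g x) → ∀ v → extend M f v ≈ᴹ extend M g v
      extend-congᶠ f≈g []            = ≈ᴹ-refl
      extend-congᶠ f≈g ((k , x) ∷ v) = +ᴹ-cong (*ₗ-congˡ (f≈g x)) (extend-congᶠ f≈g v)

      extend-++ : ∀ (f : B → Carrierᴹ) v w → extend M f (v ++ w) ≈ᴹ extend M f v +ᴹ extend M f w
      extend-++ f []            w = ≈ᴹ-sym (+ᴹ-identityˡ _)
      extend-++ f ((k , x) ∷ v) w = ≈ᴹ-trans (+ᴹ-congˡ (extend-++ f v w)) (≈ᴹ-sym (+ᴹ-assoc _ _ _))

      extend-· : ∀ (f : B → Carrierᴹ) k v → extend M f (k · v) ≈ᴹ k *ₗ extend M f v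
      extend-· f k []            = ≈ᴹ-sym (*ₗ-zeroʳ k)
      extend-· f k ((l , x) ∷ v) =
        ≈ᴹ-trans (+ᴹ-cong (*ₗ-assoc k l (f x)) (extend-· f k v)) (≈ᴹ-sym (*ₗ-distribˡ k _ _))

      extend-basis : ∀ (f : B → Carrierᴹ) x → extend M f (basis x) ≈ᴹ f x
      extend-basis f x = ≈ᴹ-trans (+ᴹ-identityʳ _) (*ₗ-identityˡ _)

      extend-+ : ∀ (f g : B → Carrierᴹ) v →
        extend M (λ x → f x +ᴹ g x) v ≈ᴹ extend M f v +ᴹ extend M g v
      extend-+ f g []            = ≈ᴹ-sym (+ᴹ-identityˡ _)
      extend-+ f g ((k , x) ∷ v) =
        ≈ᴹ-trans (+ᴹ-cong (*ₗ-distribˡ k _ _) (extend-+ f g v)) (interchange _ _ _ _)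

      extend-0ᴹ : ∀ (v : Combination B) → extend M (λ _ → 0ᴹ) v ≈ᴹ 0ᴹ
      extend-0ᴹ []            = ≈ᴹ-refl
      extend-0ᴹ ((k , x) ∷ v) = ≈ᴹ-trans (+ᴹ-cong (*ₗ-zeroʳ k) (extend-0ᴹ v)) (+ᴹ-identityˡ _)

      extend-*ₗ : ∀ k (f : B → Carrierᴹ) v → extend M (λ x → k *ₗ f x) v ≈ᴹ k *ₗ extend M f v
      extend-*ₗ k f v = ≈ᴹ-sym (Homomorphism.extend-homo M M (scale-linear k) f v)

      ∑-extend : ∀ {d} {D : Set d} xs (f : D → B → Carrierᴹ) v →
        ∑ M xs (λ y → extend M (f y) v) ≈ᴹ extend M (λ x → ∑ M xs (λ y → f y x)) v
      ∑-extend []       f v = ≈ᴹ-sym (extend-0ᴹ v)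
      ∑-extend (y ∷ xs) f v = ≈ᴹ-trans (+ᴹ-congˡ (∑-extend xs f v)) (≈ᴹ-sym (extend-+ (f y) _ v))

  module _ {b : Level} {B : Set b} (_≟_ : DecidableEquality B) where

    δ-≡ : ∀ x y → x ≡ y → δ _≟_ x y ≡ 1#
    δ-≡ x y x≡y with x ≟ y
    ... | yes _   = ≡.refl
    ... | no  x≢y = contradiction x≡y x≢y

    δ-≢ : ∀ x y → ¬ x ≡ y → δ _≟_ x y ≡ 0#
    δ-≢ x y x≢y with x ≟ y
    ... | yes x≡y = contradiction x≡y x≢y
    ... | no  _   = ≡.refl

    δ-⇔ : ∀ x y x′ y′ → (x ≡ y → x′ ≡ y′) → (x′ ≡ y′ → x ≡ y) → δ _≟_ x y ≡ δ _≟_ x′ y′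
    δ-⇔ x y x′ y′ to from with x ≟ y
    ... | yes x≡y = ≡.sym (δ-≡ x′ y′ (to x≡y))
    ... | no  x≢y = ≡.sym (δ-≢ x′ y′ (x≢y ∘ from))

    -- If the first components agree, equality of `x` and `y` amounts to equality of the second
    -- components; if they differ, both sides are zero. This peels one letter off a delta of
    -- sentences.
    δ-× : ∀ x y x₁ y₁ x₂ y₂ → (x ≡ y → x₁ ≡ y₁ × x₂ ≡ y₂) → (x₁ ≡ y₁ → x₂ ≡ y₂ → x ≡ y) →
          δ _≟_ x y ≈ δ _≟_ x₁ y₁ * δ _≟_ x₂ y₂
    δ-× x y x₁ y₁ x₂ y₂ to from with x₁ ≟ y₁
    ... | yes x₁≡y₁ =
      trans (reflexive (δ-⇔ x y x₂ y₂ (proj₂ ∘ to) (from x₁≡y₁))) (sym (*-identityˡ _))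
    ... | no  x₁≢y₁ = trans (reflexive (δ-≢ x y (x₁≢y₁ ∘ proj₁ ∘ to))) (sym (zeroˡ _))

    remove : B → Combination B → Combination B
    remove y = filter (λ (_ , x) → ¬? (y ≟ x))

    module _ {m ℓm : Level} (M : Module K m ℓm) where

      open Module M
      open CommutativeSemigroupProperties (CommutativeMonoid.commutativeSemigroup +ᴹ-commutativeMonoid)
        using (x∙yz≈y∙xz)

      -- A combination is an unnormalised list, so `y` may occur in it many times. Collecting these
      -- occurrences gives its coefficient, and `remove y v` is what is left.
      extract : ∀ (f : B → Carrierᴹ) y v →
        extend M f v ≈ᴹ coefficient _≟_ y v *ₗ f y +ᴹ extend M f (remove y v)
      extract f y []            = ≈ᴹ-sym (≈ᴹ-trans (+ᴹ-identityʳ _) (*ₗ-zeroˡ _))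
      extract f y ((k , x) ∷ v) with y ≟ x
      ... | yes ≡.refl = begin
        k *ₗ f y +ᴹ extend M f v
          ≈⟨ +ᴹ-cong (*ₗ-congʳ (sym (*-identityʳ k))) (extract f y v) ⟩
        (k * 1#) *ₗ f y +ᴹ (coefficient _≟_ y v *ₗ f y +ᴹ extend M f (remove y v))
          ≈⟨ +ᴹ-assoc _ _ _ ⟨
        ((k * 1#) *ₗ f y +ᴹ coefficient _≟_ y v *ₗ f y) +ᴹ extend M f (remove y v)
          ≈⟨ +ᴹ-congʳ (*ₗ-distribʳ (f y) _ _) ⟨
        (k * 1# + coefficient _≟_ y v) *ₗ f y +ᴹ extend M f (remove y v) ∎
        where
        open ≈-Reasoning ≈ᴹ-setoid
      ... | no _ = begin
        k *ₗ f x +ᴹ extend M f v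
          ≈⟨ +ᴹ-congˡ (extract f y v) ⟩
        k *ₗ f x +ᴹ (coefficient _≟_ y v *ₗ f y +ᴹ extend M f (remove y v))
          ≈⟨ x∙yz≈y∙xz _ _ _ ⟩
        coefficient _≟_ y v *ₗ f y +ᴹ (k *ₗ f x +ᴹ extend M f (remove y v))
          ≈⟨ +ᴹ-congʳ (*ₗ-congʳ (trans (+-congʳ (zeroʳ k)) (+-identityˡ _))) ⟨
        (k * 0# + coefficient _≟_ y v) *ₗ f y +ᴹ (k *ₗ f x +ᴹ extend M f (remove y v)) ∎
        where
        open ≈-Reasoning ≈ᴹ-setoid

    coefficient-remove : ∀ y v → coefficient _≟_ y v ≈ 0# → ∀ z →
      coefficient _≟_ z (remove y v) ≈ coefficient _≟_ z v
    coefficient-remove y v v-y z = sym (trans (extract ground (δ _≟_ z) y v)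
      (trans (+-congʳ (trans (*-congʳ v-y) (zeroˡ _))) (+-identityˡ _)))

    module _ {m ℓm : Level} (M : Module K m ℓm) (f : B → Module.Carrierᴹ M) where

      open Module M

      extend-null : ∀ n v → length v ≤ n → (∀ z → coefficient _≟_ z v ≈ 0#) → extend M f v ≈ᴹ 0ᴹ
      extend-null n       []                  _         v≋0 = ≈ᴹ-refl
      extend-null (suc n) v@((k , y) ∷ v′) (s≤s v′≤n) v≋0 = begin
        extend M f v
          ≈⟨ extract M f y v ⟩
        coefficient _≟_ y v *ₗ f y +ᴹ extend M f (remove y v)
          ≈⟨ +ᴹ-cong (≈ᴹ-trans (*ₗ-congʳ (v≋0 y)) (*ₗ-zeroˡ (f y)))
               (extend-null n (remove y v) remove≤n
                 (λ z → trans (coefficient-remove y v (v≋0 y) z) (v≋0 z))) ⟩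
        0ᴹ +ᴹ 0ᴹ
          ≈⟨ +ᴹ-identityˡ 0ᴹ ⟩
        0ᴹ ∎
        where
        open ≈-Reasoning ≈ᴹ-setoid

        remove≤n : length (remove y v) ≤ n
        -- The head of `v` is itself among the removed entries, which makes the inequality strict.
        remove≤n = ℕₚ.≤-trans
          (ℕₚ.≤-pred (filter-notAll (λ (_ , x) → ¬? (y ≟ x)) v (here (λ y≢y → y≢y ≡.refl)))) v′≤n

      -- All coefficients of the difference of `v` and `w` vanish, so `extend-null` applies.
      -- Compared with the case `v = w`, this shows that `extend M f` depends only on the class of a
      -- combination under `≋`.
      extend-inverseʳ : ∀ v w → Module._≈ᴹ_ (free _≟_) v w → extend M f v +ᴹ extend M f (- 1# · w) ≈ᴹ 0ᴹ
      extend-inverseʳ v w v≋w = ≈ᴹ-trans (≈ᴹ-sym (extend-++ M f v _))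
        (extend-null _ (v ++ - 1# · w) ℕₚ.≤-refl
          (Free.≈ᴹ-trans {v ++ - 1# · w} {w ++ - 1# · w} {[]}
            (Free.+ᴹ-congʳ { - 1# · w} {v} {w} v≋w) (Free.-ᴹ‿inverseʳ w)))
        where module Free = Module (free _≟_)

      extend-linear : IsLinear (free _≟_) M (extend M f)
      extend-linear = record { isBimoduleHomomorphism = record
        { +ᴹ-isGroupHomomorphism = record
          { isMonoidHomomorphism = record
            { isMagmaHomomorphism = record
              { isRelHomomorphism = record { cong = λ {v} {w} v≋w →
                  ∙-cancelʳ (extend M f (- 1# · w)) _ _
                    (≈ᴹ-trans (extend-inverseʳ v w v≋w)
                      (≈ᴹ-sym (extend-inverseʳ w w (λ _ → refl)))) }
              ; homo = extend-++ M f
              }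
            ; ε-homo = ≈ᴹ-refl
            }
          ; ⁻¹-homo = λ v → uniqueʳ‿-ᴹ (extend M f v) _ (extend-inverseʳ v v (λ _ → refl))
          }
        ; *ₗ-homo = extend-· M f
        ; *ᵣ-homo = λ k v → ≈ᴹ-trans (extend-· M f k v) (*ₗ-*ᵣ-coincident k _)
        } }
        where
        open GroupProperties +ᴹ-group using (∙-cancelʳ)

    extend-basis-identity : ∀ v → Module._≈ᴹ_ (free _≟_) (extend (free _≟_) basis v) v
    extend-basis-identity v x = trans
      (Homomorphism.extend-homo (free _≟_) ground (extend-linear ground (δ _≟_ x)) basis v)
      (extend-congᶠ ground (extend-basis ground (δ _≟_ x)) v)

-- Letterwise induction, complements and splittings of sentences.

module SentenceCombinatorics {a : Level} {A : Set a} where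

  open Sentences A
  open SentenceProperties {A = A}

  -- A view of a sentence as built from its last letter backwards: each new letter becomes a word of
  -- its own or joins the first word. These are the two cases distinguished by `refineWord` and
  -- `cut`.
  data Letterwise : Sentence → Set a where
    empty  : Letterwise []
    single : ∀ x {I} → Letterwise I → Letterwise ((x ∷ []) ∷ I)
    attach : ∀ x {w I} → Letterwise (w ∷ I) → Letterwise (x ◂ (w ∷ I))

  letterwise : ∀ I → Letterwise I
  letterwise []            = empty
  letterwise ((x ∷ w) ∷ I) = word x w
    where
    word : ∀ x w → Letterwise ((x ∷ w) ∷ I)
    word x []      = single x (letterwise I)
    word x (y ∷ w) = attach x (word y w)

  ◂≢[] : ∀ {x} I → ¬ x ◂ I ≡ []
  ◂≢[] []      ()
  ◂≢[] (w ∷ I) ()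

  ◂-injective : ∀ {x y} I J → x ◂ I ≡ y ◂ J → x ≡ y × I ≡ J
  ◂-injective []      []      ≡.refl = ≡.refl , ≡.refl
  ◂-injective (_ ∷ _) (_ ∷ _) ≡.refl = ≡.refl , ≡.refl

  -- The second word `w` matters: `y ◂ []` is a one-letter sentence.
  single≢◂ : ∀ {x y w I} J → ¬ (x ∷ []) ∷ w ∷ I ≡ y ◂ J
  single≢◂ []      ()
  single≢◂ (_ ∷ _) ()

  ∈-refinements-nonEmpty : ∀ w I {K} → K ∈ refinements (w ∷ I) → ∃₂ λ v J → K ≡ v ∷ J
  ∈-refinements-nonEmpty w I {K} K∈ with Equivalence.to (∈-refinements (w ∷ I) K) K∈
  ... | (v ∷ _) ∷ _ , ≡.refl , _ = _ , _ , ≡.refl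

  -- The entry `false` between `x` and the next letter is negated, so `cut` separates `x`. The case
  -- split only lets `separations` see whether the first word is the last one.
  ᶜ-◂ : ∀ x w I → (x ◂ (w ∷ I)) ᶜ ≡ (x ∷ []) ∷ (w ∷ I) ᶜ
  ᶜ-◂ x w []      = ≡.refl
  ᶜ-◂ x w (_ ∷ _) = ≡.refl

  ᶜ-nonEmpty : ∀ w I → ∃₂ λ v J → (w ∷ I) ᶜ ≡ v ∷ J
  -- An empty complement would have an empty maximal word, which `maximalWord-ᶜ` excludes.
  ᶜ-nonEmpty w I with (w ∷ I) ᶜ | maximalWord-ᶜ (w ∷ I)
  ... | v ∷ J | _ = v , J , ≡.refl

  -- Complementation exchanges the constructors `single` and `attach` at every letter but the last,
  -- and the last letter stays as it is.
  ᶜ-involutive : ∀ I → I ᶜ ᶜ ≡ I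
  ᶜ-involutive I = go (letterwise I)
    where
    go : ∀ {I} → Letterwise I → I ᶜ ᶜ ≡ I
    go empty                  = ≡.refl
    go (single x empty)       = ≡.refl
    go (single x {w ∷ I} view) with (w ∷ I) ᶜ | ᶜ-nonEmpty w I | go view
    ... | _ | v , J , ≡.refl | ih = ≡.trans (ᶜ-◂ x v J) (≡.cong ((x ∷ []) ∷_) ih)
    go (attach x {w} {I} view) = ≡.trans (≡.cong _ᶜ (ᶜ-◂ x w I)) attached
      where
      attached : ((x ∷ []) ∷ (w ∷ I) ᶜ) ᶜ ≡ x ◂ (w ∷ I)
      attached with (w ∷ I) ᶜ | ᶜ-nonEmpty w I | go view
      ... | _ | v , J , ≡.refl | ih = ≡.cong (x ◂_) ih

  ∣ᶜ∣ : ∀ I → ∣ I ᶜ ∣ ≡ ∣ I ∣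
  ∣ᶜ∣ I = ≡.cong length (maximalWord-ᶜ I)

  maximalWord-tilde : ∀ ws → maximalWord (tilde ws) ≡ concat ws
  maximalWord-tilde []             = ≡.refl
  maximalWord-tilde ([]      ∷ ws) = maximalWord-tilde ws
  maximalWord-tilde ((x ∷ w) ∷ ws) = ≡.cong (λ v → x ∷ w ++ v) (maximalWord-tilde ws)

  tilde-∷ : ∀ w ws → tilde (w ∷ ws) ≡ tilde (w ∷ []) ++ tilde ws
  tilde-∷ []      ws = ≡.refl
  tilde-∷ (x ∷ w) ws = ≡.refl

  tilde-ʳ++ : ∀ w ws I → tilde (w ∷ ws) ʳ++ I ≡ tilde ws ʳ++ (tilde (w ∷ []) ++ I)
  tilde-ʳ++ []      ws I = ≡.refl
  tilde-ʳ++ (x ∷ w) ws I = ≡.refl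

  -- The splitting with `J = I`; its term in the convolution of the identity with `S` is `S (H I)`
  -- itself.
  fullSplitting : Sentence → List (Word × Word)
  fullSplitting = map (λ w → [] , toList w)

  tilde-fullSplitting₁ : ∀ I → tilde (map proj₁ (fullSplitting I)) ≡ []
  tilde-fullSplitting₁ []      = ≡.refl
  tilde-fullSplitting₁ (w ∷ I) = tilde-fullSplitting₁ I

  tilde-fullSplitting₂ : ∀ I → tilde (map proj₂ (fullSplitting I)) ≡ I
  tilde-fullSplitting₂ []      = ≡.refl
  tilde-fullSplitting₂ (w ∷ I) = ≡.cong (w ∷_) (tilde-fullSplitting₂ I)

  length-factor₂ : ∀ (u v : Word) {w} → u ++ v ≡ w → length v ≤ length w
  length-factor₂ u v ≡.refl = ≡.subst (length v ≤_) (≡.sym (length-++ u)) (ℕₚ.m≤n+m _ _)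

  length-splitting₂ : ∀ {P I} → IsSplitting P I → length (concat (map proj₂ P)) ≤ ∣ I ∣
  length-splitting₂ []                            = z≤n
  length-splitting₂ {(u , v) ∷ P} {w ∷ I} (uv≡w ∷ split) =
    ≡.subst₂ _≤_ (≡.sym (length-++ v)) (≡.sym (length-++ (toList w)))
      (ℕₚ.+-mono-≤ (length-factor₂ u v uv≡w) (length-splitting₂ split))

  -- Prepares the induction for the antipode: the term with `J = I` heads the list, and every other
  -- term has a `J` with strictly fewer letters than `I`.
  record FullSplittingFirst (I : Sentence) : Set a where
    field
      others   : List (List (Word × Word))
      first    : splittings I ≡ fullSplitting I ∷ others
      shorter  : ∀ {P} → P ∈ others → length (concat (map proj₂ P)) < ∣ I ∣

  fullSplitting-first : ∀ I → FullSplittingFirst I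
  fullSplitting-first []            = record { others = [] ; first = ≡.refl ; shorter = λ () }
  fullSplitting-first ((x ∷ w) ∷ I) = record
    -- Either the first word goes entirely to the second factor and a later word does not, or the
    -- first word gives up its letter `x`.
    { others  = map (([] , x ∷ w) ∷_) ih.others ++ others₂
    ; first   = ≡.cong (λ Ps → map (([] , x ∷ w) ∷_) Ps ++ others₂) ih.first
    ; shorter = λ P∈ → [ shorter₁ , shorter₂ ]′ (∈-++⁻ (map (([] , x ∷ w) ∷_) ih.others) P∈)
    }
    where
    module ih = FullSplittingFirst (fullSplitting-first I)

    others₂ : List (List (Word × Word))
    others₂ = cartesianProductWith _∷_ (map (map₁ (x ∷_)) (factorisations w)) (splittings I)

    shorter₁ : ∀ {P} → P ∈ map (([] , x ∷ w) ∷_) ih.others →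
               length (concat (map proj₂ P)) < ∣ (x ∷ w) ∷ I ∣
    shorter₁ P∈ with ∈-map⁻ _ P∈
    ... | P′ , P′∈ , ≡.refl = s≤s (≡.subst₂ _<_ (≡.sym (length-++ w)) (≡.sym (length-++ w))
      (ℕₚ.+-monoʳ-< (length w) (ih.shorter P′∈)))

    shorter₂ : ∀ {P} → P ∈ others₂ → length (concat (map proj₂ P)) < ∣ (x ∷ w) ∷ I ∣
    shorter₂ P∈ with ∈-cartesianProductWith⁻ _∷_ (map (map₁ (x ∷_)) (factorisations w)) (splittings I) P∈
    ... | _ , P′ , uv∈ , P′∈ , ≡.refl with ∈-map⁻ _ uv∈
    ...   | (u , v) , uv∈′ , ≡.refl
      with Equivalence.to (∈-splittings ((x ∷ w) ∷ I) _)
             (∈-++⁺ʳ (map (([] , x ∷ w) ∷_) (splittings I)) P∈)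
    -- The letter `x` lies in the first factor and accounts for the strict inequality, so weak
    -- bounds suffice for all other letters.
    ...     | uv≡w ∷ split = s≤s (≡.subst₂ _≤_ (≡.sym (length-++ v)) (≡.sym (length-++ w))
      (ℕₚ.+-mono-≤ (length-factor₂ u v (∷-injectiveʳ uv≡w)) (length-splitting₂ split)))

module Ribbons {c ℓ₁ ℓ₂ a : Level} (𝕜 : HeytingField c ℓ₁ ℓ₂)
               {A : Set a} {n : ℕ} (finite : A ↔ Fin n) where

  open Symmetric 𝕜 finite
  open SentenceProperties {A = A}
  open SentenceCombinatorics {A = A}
  open LinearAlgebra ring
  open CommutativeRing ring hiding (ring; zero)
  open CommutativeSemigroupProperties *-commutativeSemigroup using (x∙yz≈y∙xz)
  open GroupProperties +-group using () renaming (∙-cancelˡ to +-cancelˡ)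
  open RingProperties (CommutativeRing.ring ring) using (-1*x≈-x)
  module N = Module NSym
  module N⊗N = Module NSym⊗NSym

  -- Linear extensions of maps of sentences, and deltas of sentences letter by letter.

  ⟪_⟫ : (Sentence → Sentence) → ∣NSym∣ → ∣NSym∣
  ⟪ f ⟫ = extend NSym (H ∘ f)

  module ⟪⟫ (f : Sentence → Sentence) = Homomorphism NSym NSym (extend-linear _≟_ NSym (H ∘ f))

  ⟪⟫-cong : ∀ f v w → v ≈ᴹ w → ⟪ f ⟫ v ≈ᴹ ⟪ f ⟫ w
  ⟪⟫-cong f v w = ⟪⟫.⟦⟧-cong f {v} {w}

  ⟪⟫-∘ : ∀ f g v → ⟪ f ⟫ (⟪ g ⟫ v) ≈ᴹ ⟪ f ∘ g ⟫ v
  ⟪⟫-∘ f g v = begin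
    ⟪ f ⟫ (⟪ g ⟫ v)                 ≈⟨ ⟪⟫.extend-homo f (H ∘ g) v ⟩
    extend NSym (⟪ f ⟫ ∘ H ∘ g) v   ≈⟨ extend-congᶠ NSym (λ L → extend-basis NSym (H ∘ f) (g L)) v ⟩
    ⟪ f ∘ g ⟫ v                     ∎
    where
    open ≈-Reasoning N.≈ᴹ-setoid

  -1*x+x≈0 : ∀ x → - 1# * x + x ≈ 0#
  -1*x+x≈0 x = trans (+-congʳ (-1*x≈-x x)) (-‿inverseˡ x)

  extract-sign : ∀ {k s x y} → x ≈ s * y → - 1# * (k * x) ≈ (- 1# * s) * (k * y)
  extract-sign x≈sy =
    trans (*-congˡ (trans (*-congˡ x≈sy) (x∙yz≈y∙xz _ _ _))) (sym (*-assoc _ _ _))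

  -- The Kronecker delta of two letters, expressed through one-letter sentences.
  κ : A → A → Carrier
  κ x y = δ _≟_ ((x ∷ []) ∷ []) ((y ∷ []) ∷ [])

  δ-single : ∀ x y I J → δ _≟_ ((x ∷ []) ∷ I) ((y ∷ []) ∷ J) ≈ κ x y * δ _≟_ I J
  δ-single x y I J = δ-× _≟_ ((x ∷ []) ∷ I) ((y ∷ []) ∷ J) ((x ∷ []) ∷ []) ((y ∷ []) ∷ []) I J
    (λ { ≡.refl → ≡.refl , ≡.refl }) λ { ≡.refl ≡.refl → ≡.refl }

  δ-◂ : ∀ x y I J → δ _≟_ (x ◂ I) (y ◂ J) ≈ κ x y * δ _≟_ I J
  δ-◂ x y I J = δ-× _≟_ (x ◂ I) (y ◂ J) ((x ∷ []) ∷ []) ((y ∷ []) ∷ []) I J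
    (λ eq → map₁ (≡.cong (λ z → (z ∷ []) ∷ [])) (◂-injective I J eq))
    λ { ≡.refl ≡.refl → ≡.refl }

  -- The values of the fundamental functions on the basis `H`.

  -- e J L is ⟨ F J , H L ⟩: see ⟨F,⟩≈E below.

  e : Sentence → Sentence → Carrier
  e J L = ∑ ground (refinements J) (λ K → δ _≟_ K L)

  E : Sentence → ∣NSym∣ → Carrier
  E J = extend ground (e J)

  module E (J : Sentence) = Homomorphism NSym ground (extend-linear _≟_ ground (e J))

  ∑-*ˡ : ∀ (Ks : List Sentence) k (f : Sentence → Carrier) →
    ∑ ground Ks (λ K → k * f K) ≈ k * ∑ ground Ks f
  ∑-*ˡ Ks k f = sym (Homomorphism.∑-homo ground ground (scale-linear ground k) Ks f)

  e-[]-nonEmpty : ∀ L → ¬ L ≡ [] → e [] L ≈ 0#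
  e-[]-nonEmpty L L≢[] = trans (+-identityʳ _) (reflexive (δ-≢ _≟_ [] L (L≢[] ∘ ≡.sym)))

  e-nonEmpty-[] : ∀ w J → e (w ∷ J) [] ≈ 0#
  e-nonEmpty-[] w J = ∑-vanish ground (refinements (w ∷ J)) (vanish ∘ ∈-refinements-nonEmpty w J)
    where
    vanish : ∀ {K} → ∃₂ (λ v I → K ≡ v ∷ I) → δ _≟_ K [] ≈ 0#
    vanish (v , I , ≡.refl) = reflexive (δ-≢ _≟_ (v ∷ I) [] λ ())

  e-single-single : ∀ x z J L → e ((x ∷ []) ∷ J) ((z ∷ []) ∷ L) ≈ κ x z * e J L
  e-single-single x z J L = trans (∑-map ground ((x ∷ []) ∷_) (refinements J) _)
    (trans (∑-cong ground (refinements J) (λ K → δ-single x z K L)) (∑-*ˡ (refinements J) _ _))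

  -- Each refinement on the left has the one-letter word `x` followed by a further word, whereas
  -- `z ◂ L` joins its first letter to another one or consists of one letter only.
  e-single-◂ : ∀ x z w J L → e ((x ∷ []) ∷ w ∷ J) (z ◂ L) ≈ 0#
  e-single-◂ x z w J L = trans (∑-map ground ((x ∷ []) ∷_) (refinements (w ∷ J)) _)
    (∑-vanish ground (refinements (w ∷ J)) (vanish ∘ ∈-refinements-nonEmpty w J))
    where
    vanish : ∀ {K} → ∃₂ (λ v I → K ≡ v ∷ I) → δ _≟_ ((x ∷ []) ∷ K) (z ◂ L) ≈ 0#
    vanish (_ , _ , ≡.refl) = reflexive (δ-≢ _≟_ _ (z ◂ L) (single≢◂ L))

  -- The boundary case: for empty `L` the sentence `z ◂ L` is the one-letter word, so the value need
  -- not vanish.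
  e-letter-◂ : ∀ x z L → e ((x ∷ []) ∷ []) (z ◂ L) ≈ κ x z * e [] L
  e-letter-◂ x z L = trans (+-identityʳ _) (trans (δ-◂ x z [] L) (*-congˡ (sym (+-identityʳ _))))

  -- Of the two halves of the refinements, those separating `x` and those attaching it, only the
  -- first can match a sentence that begins with a one-letter word.
  e-◂-single : ∀ x z w J L → e (x ◂ (w ∷ J)) ((z ∷ []) ∷ L) ≈ κ x z * e (w ∷ J) L
  e-◂-single x z w J L = begin
    ∑ ground (map ((x ∷ []) ∷_) Ks ++ map (x ◂_) Ks) f
      ≈⟨ ∑-++ ground (map ((x ∷ []) ∷_) Ks) _ f ⟩
    ∑ ground (map ((x ∷ []) ∷_) Ks) f + ∑ ground (map (x ◂_) Ks) f
      ≈⟨ +-cong (e-single-single x z (w ∷ J) L) (trans (∑-map ground (x ◂_) Ks f)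
           (∑-vanish ground Ks (vanish ∘ ∈-refinements-nonEmpty w J))) ⟩
    κ x z * e (w ∷ J) L + 0#
      ≈⟨ +-identityʳ _ ⟩
    κ x z * e (w ∷ J) L ∎
    where
    open ≈-Reasoning setoid

    Ks : List Sentence
    Ks = refinements (w ∷ J)

    f : Sentence → Carrier
    f K = δ _≟_ K ((z ∷ []) ∷ L)

    vanish : ∀ {K} → ∃₂ (λ v I → K ≡ v ∷ I) → f (x ◂ K) ≈ 0#
    vanish (v , I , ≡.refl) = reflexive (δ-≢ _≟_ (x ◂ (v ∷ I)) ((z ∷ []) ∷ L) λ ())

  -- Here only the refinements attaching `x` contribute; the others cancel out of the sum by
  -- `e-single-◂`.
  e-◂-◂ : ∀ x z w J L → e (x ◂ (w ∷ J)) (z ◂ L) ≈ κ x z * e (w ∷ J) L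
  e-◂-◂ x z w J L = begin
    ∑ ground (map ((x ∷ []) ∷_) Ks ++ map (x ◂_) Ks) f
      ≈⟨ ∑-++ ground (map ((x ∷ []) ∷_) Ks) _ f ⟩
    ∑ ground (map ((x ∷ []) ∷_) Ks) f + ∑ ground (map (x ◂_) Ks) f
      ≈⟨ +-cong (e-single-◂ x z w J L) (trans (∑-map ground (x ◂_) Ks f)
           (trans (∑-cong ground Ks (λ K → δ-◂ x z K L)) (∑-*ˡ Ks _ _))) ⟩
    0# + κ x z * e (w ∷ J) L
      ≈⟨ +-identityˡ _ ⟩
    κ x z * e (w ∷ J) L ∎
    where
    open ≈-Reasoning setoid

    Ks : List Sentence
    Ks = refinements (w ∷ J)

    f : Sentence → Carrier
    f K = δ _≟_ K (z ◂ L)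

  -- The complement is one letter if `J` is empty and attaches `x` to `J ᶜ` otherwise; the rules for
  -- the two cases agree.
  e-ᶜ-single : ∀ x z J L → e (((x ∷ []) ∷ J) ᶜ) ((z ∷ []) ∷ L) ≈ κ x z * e (J ᶜ) L
  e-ᶜ-single x z []      L = e-single-single x z [] L
  e-ᶜ-single x z (w ∷ J) L with (w ∷ J) ᶜ | ᶜ-nonEmpty w J
  ... | _ | v , K , ≡.refl = e-◂-single x z v K L

  -- Carries the letter rules for `e` over to arbitrary combinations, in particular to `Φ I`.
  E-⟪⟫ : ∀ J J′ f k → (∀ L → e J (f L) ≈ k * e J′ L) → ∀ v → E J (⟪ f ⟫ v) ≈ k * E J′ v
  E-⟪⟫ J J′ f k rule v = begin
    E J (⟪ f ⟫ v)                          ≈⟨ E.extend-homo J (H ∘ f) v ⟩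
    extend ground (E J ∘ H ∘ f) v
      ≈⟨ extend-congᶠ ground (λ L → trans (extend-basis ground (e J) (f L)) (rule L)) v ⟩
    extend ground (λ L → k * e J′ L) v     ≈⟨ extend-*ₗ ground k (e J′) v ⟩
    k * E J′ v                             ∎
    where
    open ≈-Reasoning setoid

  E-⟪⟫-zero : ∀ J f → (∀ L → e J (f L) ≈ 0#) → ∀ v → E J (⟪ f ⟫ v) ≈ 0#
  E-⟪⟫-zero J f rule v =
    trans (E-⟪⟫ J [] f 0# (λ L → trans (rule L) (sym (zeroˡ _))) v) (zeroˡ _)

  -- The signed sum `Φ` and its pairing with the fundamental functions.

  -- Φ I is the sum over J ≼ I of (-1)^(number of words of J) H J, built letter by
  -- letter: a letter either forms a word of its own in J or joins the next word.

  Φʷ : A → List A → ∣NSym∣ → ∣NSym∣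
  Φʷ x []      v = - 1# *ₗ ⟪ (x ∷ []) ∷_ ⟫ v
  Φʷ x (y ∷ w) v = - 1# *ₗ ⟪ (x ∷ []) ∷_ ⟫ (Φʷ y w v) N.+ᴹ ⟪ x ◂_ ⟫ (Φʷ y w v)

  Φ : Sentence → ∣NSym∣
  Φ []            = H []
  Φ ((x ∷ w) ∷ I) = Φʷ x w (Φ I)

  E-Φ-single : ∀ J z I → E J (Φ ((z ∷ []) ∷ I)) ≈ - 1# * E J (⟪ (z ∷ []) ∷_ ⟫ (Φ I))
  E-Φ-single J z I = E.*ₗ-homo J (- 1#) (⟪ (z ∷ []) ∷_ ⟫ (Φ I))

  E-Φ-◂ : ∀ J z w I → E J (Φ (z ◂ (w ∷ I))) ≈
    - 1# * E J (⟪ (z ∷ []) ∷_ ⟫ (Φ (w ∷ I))) + E J (⟪ z ◂_ ⟫ (Φ (w ∷ I)))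
  E-Φ-◂ J z w I = trans (E.+ᴹ-homo J (- 1# *ₗ ⟪ (z ∷ []) ∷_ ⟫ (Φ (w ∷ I))) _)
    (+-congʳ (E.*ₗ-homo J (- 1#) (⟪ (z ∷ []) ∷_ ⟫ (Φ (w ∷ I)))))

  -- Simultaneous induction on both views. A first letter at which the sum survives contributes
  -- `- 1#` to the sign and `κ x z` to the value, on both sides.
  E-Φ : ∀ {J I} → Letterwise J → Letterwise I → E J (Φ I) ≈ sign ∣ J ∣ * e (J ᶜ) I
  E-Φ empty empty = trans (extend-basis ground (e []) []) (sym (*-identityˡ _))
  E-Φ empty (single z {I} _) = begin
    E [] (Φ ((z ∷ []) ∷ I))                  ≈⟨ E-Φ-single [] z I ⟩
    - 1# * E [] (⟪ (z ∷ []) ∷_ ⟫ (Φ I))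
      ≈⟨ *-congˡ (E-⟪⟫-zero [] ((z ∷ []) ∷_) (λ L → e-[]-nonEmpty ((z ∷ []) ∷ L) λ ()) (Φ I)) ⟩
    - 1# * 0#                                ≈⟨ zeroʳ _ ⟩
    0#                                       ≈⟨ zeroʳ _ ⟨
    1# * 0#                                  ≈⟨ *-congˡ (e-[]-nonEmpty ((z ∷ []) ∷ I) λ ()) ⟨
    1# * e [] ((z ∷ []) ∷ I)                 ∎
    where
    open ≈-Reasoning setoid
  E-Φ empty (attach z {w} {I} _) = begin
    E [] (Φ (z ◂ (w ∷ I)))
      ≈⟨ E-Φ-◂ [] z w I ⟩
    - 1# * E [] (⟪ (z ∷ []) ∷_ ⟫ (Φ (w ∷ I))) + E [] (⟪ z ◂_ ⟫ (Φ (w ∷ I)))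
      ≈⟨ +-cong (*-congˡ (E-⟪⟫-zero [] ((z ∷ []) ∷_) (λ L → e-[]-nonEmpty ((z ∷ []) ∷ L) λ ()) (Φ (w ∷ I))))
                (E-⟪⟫-zero [] (z ◂_) (λ L → e-[]-nonEmpty (z ◂ L) (◂≢[] L)) (Φ (w ∷ I))) ⟩
    - 1# * 0# + 0#
      ≈⟨ -1*x+x≈0 0# ⟩
    0#
      ≈⟨ zeroʳ _ ⟨
    1# * 0#
      ≈⟨ *-congˡ (e-[]-nonEmpty (z ◂ (w ∷ I)) λ ()) ⟨
    1# * e [] (z ◂ (w ∷ I)) ∎
    where
    open ≈-Reasoning setoid
  E-Φ {w ∷ J} _ empty with (w ∷ J) ᶜ | ᶜ-nonEmpty w J
  ... | _ | v , K , ≡.refl = begin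
    E (w ∷ J) (H [])                         ≈⟨ extend-basis ground (e (w ∷ J)) [] ⟩
    e (w ∷ J) []                             ≈⟨ e-nonEmpty-[] w J ⟩
    0#                                       ≈⟨ zeroʳ _ ⟨
    sign ∣ w ∷ J ∣ * 0#                      ≈⟨ *-congˡ (e-nonEmpty-[] v K) ⟨
    sign ∣ w ∷ J ∣ * e (v ∷ K) []            ∎
    where
    open ≈-Reasoning setoid
  E-Φ (single x {J} viewJ) (single z {I} viewI) = begin
    E ((x ∷ []) ∷ J) (Φ ((z ∷ []) ∷ I))
      ≈⟨ E-Φ-single ((x ∷ []) ∷ J) z I ⟩
    - 1# * E ((x ∷ []) ∷ J) (⟪ (z ∷ []) ∷_ ⟫ (Φ I))
      ≈⟨ *-congˡ (E-⟪⟫ ((x ∷ []) ∷ J) J ((z ∷ []) ∷_) _ (e-single-single x z J) (Φ I)) ⟩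
    - 1# * (κ x z * E J (Φ I))
      ≈⟨ extract-sign (E-Φ viewJ viewI) ⟩
    (- 1# * sign ∣ J ∣) * (κ x z * e (J ᶜ) I)
      ≈⟨ *-congˡ (e-ᶜ-single x z J I) ⟨
    (- 1# * sign ∣ J ∣) * e (((x ∷ []) ∷ J) ᶜ) ((z ∷ []) ∷ I) ∎
    where
    open ≈-Reasoning setoid
  E-Φ (single x {[]} viewJ) (attach z {w} {I} viewI) = begin
    E ((x ∷ []) ∷ []) (Φ (z ◂ (w ∷ I)))
      ≈⟨ E-Φ-◂ ((x ∷ []) ∷ []) z w I ⟩
    - 1# * E ((x ∷ []) ∷ []) (⟪ (z ∷ []) ∷_ ⟫ (Φ (w ∷ I))) + E ((x ∷ []) ∷ []) (⟪ z ◂_ ⟫ (Φ (w ∷ I)))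
      -- As `J` is a single letter, separating `z` and attaching `z` give the same value, and the
      -- two summands cancel. The right side vanishes because `w ∷ I` is not empty.
      ≈⟨ +-cong
           (*-congˡ (E-⟪⟫ ((x ∷ []) ∷ []) [] ((z ∷ []) ∷_) _ (e-single-single x z []) (Φ (w ∷ I))))
           (E-⟪⟫ ((x ∷ []) ∷ []) [] (z ◂_) _ (e-letter-◂ x z) (Φ (w ∷ I))) ⟩
    - 1# * (κ x z * E [] (Φ (w ∷ I))) + κ x z * E [] (Φ (w ∷ I))
      ≈⟨ -1*x+x≈0 _ ⟩
    0#
      ≈⟨ trans (*-congˡ (trans (*-congˡ (e-[]-nonEmpty (w ∷ I) λ ())) (zeroʳ _))) (zeroʳ _) ⟨
    (- 1# * 1#) * (κ x z * e [] (w ∷ I))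
      ≈⟨ *-congˡ (e-letter-◂ x z (w ∷ I)) ⟨
    (- 1# * 1#) * e ((x ∷ []) ∷ []) (z ◂ (w ∷ I)) ∎
    where
    open ≈-Reasoning setoid
  E-Φ (single x {v ∷ J} viewJ) (attach z {w} {I} viewI) = begin
    E ((x ∷ []) ∷ v ∷ J) (Φ (z ◂ (w ∷ I)))
      ≈⟨ E-Φ-◂ ((x ∷ []) ∷ v ∷ J) z w I ⟩
    - 1# * E ((x ∷ []) ∷ v ∷ J) (⟪ (z ∷ []) ∷_ ⟫ (Φ (w ∷ I))) + E ((x ∷ []) ∷ v ∷ J) (⟪ z ◂_ ⟫ (Φ (w ∷ I)))
      ≈⟨ +-cong
           (*-congˡ (E-⟪⟫ ((x ∷ []) ∷ v ∷ J) (v ∷ J) ((z ∷ []) ∷_) _ (e-single-single x z (v ∷ J)) (Φ (w ∷ I))))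
           (E-⟪⟫-zero ((x ∷ []) ∷ v ∷ J) (z ◂_) (e-single-◂ x z v J) (Φ (w ∷ I))) ⟩
    - 1# * (κ x z * E (v ∷ J) (Φ (w ∷ I))) + 0#
      ≈⟨ +-identityʳ _ ⟩
    - 1# * (κ x z * E (v ∷ J) (Φ (w ∷ I)))
      ≈⟨ extract-sign (E-Φ viewJ viewI) ⟩
    (- 1# * sign ∣ v ∷ J ∣) * (κ x z * e ((v ∷ J) ᶜ) (w ∷ I))
      ≈⟨ *-congˡ e-ᶜ-◂ ⟨
    (- 1# * sign ∣ v ∷ J ∣) * e (x ◂ (v ∷ J) ᶜ) (z ◂ (w ∷ I)) ∎
    where
    open ≈-Reasoning setoid

    e-ᶜ-◂ : e (x ◂ (v ∷ J) ᶜ) (z ◂ (w ∷ I)) ≈ κ x z * e ((v ∷ J) ᶜ) (w ∷ I)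
    e-ᶜ-◂ with (v ∷ J) ᶜ | ᶜ-nonEmpty v J
    ... | _ | u , K , ≡.refl = e-◂-◂ x z u K (w ∷ I)
  E-Φ (attach x {v} {J} viewJ) (single z {I} viewI) = begin
    E (x ◂ (v ∷ J)) (Φ ((z ∷ []) ∷ I))
      ≈⟨ E-Φ-single (x ◂ (v ∷ J)) z I ⟩
    - 1# * E (x ◂ (v ∷ J)) (⟪ (z ∷ []) ∷_ ⟫ (Φ I))
      ≈⟨ *-congˡ (E-⟪⟫ (x ◂ (v ∷ J)) (v ∷ J) ((z ∷ []) ∷_) _ (e-◂-single x z v J) (Φ I)) ⟩
    - 1# * (κ x z * E (v ∷ J) (Φ I))
      ≈⟨ extract-sign (E-Φ viewJ viewI) ⟩
    (- 1# * sign ∣ v ∷ J ∣) * (κ x z * e ((v ∷ J) ᶜ) I)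
      ≈⟨ *-congˡ (e-single-single x z ((v ∷ J) ᶜ) I) ⟨
    (- 1# * sign ∣ v ∷ J ∣) * e ((x ∷ []) ∷ (v ∷ J) ᶜ) ((z ∷ []) ∷ I)
      ≡⟨ ≡.cong (λ K → sign ∣ x ◂ (v ∷ J) ∣ * e K ((z ∷ []) ∷ I)) (ᶜ-◂ x v J) ⟨
    sign ∣ x ◂ (v ∷ J) ∣ * e ((x ◂ (v ∷ J)) ᶜ) ((z ∷ []) ∷ I) ∎
    where
    open ≈-Reasoning setoid
  E-Φ (attach x {v} {J} viewJ) (attach z {w} {I} viewI) = begin
    E (x ◂ (v ∷ J)) (Φ (z ◂ (w ∷ I)))
      ≈⟨ E-Φ-◂ (x ◂ (v ∷ J)) z w I ⟩
    - 1# * E (x ◂ (v ∷ J)) (⟪ (z ∷ []) ∷_ ⟫ (Φ (w ∷ I))) + E (x ◂ (v ∷ J)) (⟪ z ◂_ ⟫ (Φ (w ∷ I)))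
      -- Since `J` joins `x` to the next letter, its refinements match both choices for `z` equally,
      -- and the opposite signs cancel.
      ≈⟨ +-cong
           (*-congˡ (E-⟪⟫ (x ◂ (v ∷ J)) (v ∷ J) ((z ∷ []) ∷_) _ (e-◂-single x z v J) (Φ (w ∷ I))))
           (E-⟪⟫ (x ◂ (v ∷ J)) (v ∷ J) (z ◂_) _ (e-◂-◂ x z v J) (Φ (w ∷ I))) ⟩
    - 1# * (κ x z * E (v ∷ J) (Φ (w ∷ I))) + κ x z * E (v ∷ J) (Φ (w ∷ I))
      ≈⟨ -1*x+x≈0 _ ⟩
    0#
      ≈⟨ zeroʳ _ ⟨
    sign ∣ x ◂ (v ∷ J) ∣ * 0#
      ≈⟨ *-congˡ e-ᶜ-◂ ⟨
    sign ∣ x ◂ (v ∷ J) ∣ * e ((x ∷ []) ∷ (v ∷ J) ᶜ) (z ◂ (w ∷ I))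
      ≡⟨ ≡.cong (λ K → sign ∣ x ◂ (v ∷ J) ∣ * e K (z ◂ (w ∷ I))) (ᶜ-◂ x v J) ⟨
    sign ∣ x ◂ (v ∷ J) ∣ * e ((x ◂ (v ∷ J)) ᶜ) (z ◂ (w ∷ I)) ∎
    where
    open ≈-Reasoning setoid

    e-ᶜ-◂ : e ((x ∷ []) ∷ (v ∷ J) ᶜ) (z ◂ (w ∷ I)) ≈ 0#
    e-ᶜ-◂ with (v ∷ J) ᶜ | ᶜ-nonEmpty v J
    ... | _ | u , K , ≡.refl = e-single-◂ x z u K (w ∷ I)

  -- Left multiplication by `H K`, and the vanishing convolution sums of `Φ`.

  leftMul : Sentence → ∣NSym∣ → ∣NSym∣
  leftMul K = ⟪ K ++_ ⟫

  leftMul-[] : ∀ v → leftMul [] v ≈ᴹ v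
  leftMul-[] = extend-basis-identity _≟_

  leftMul-++ : ∀ I J v → leftMul (I ++ J) v ≈ᴹ leftMul I (leftMul J v)
  leftMul-++ I J v = begin
    ⟪ (I ++ J) ++_ ⟫ v        ≈⟨ extend-congᶠ NSym (λ L → N.≈ᴹ-reflexive (≡.cong H (++-assoc I J L))) v ⟩
    ⟪ (I ++_) ∘ (J ++_) ⟫ v   ≈⟨ ⟪⟫-∘ (I ++_) (J ++_) v ⟨
    leftMul I (leftMul J v)   ∎
    where
    open ≈-Reasoning N.≈ᴹ-setoid

  ◂-leftMul : ∀ x y w v →
    ⟪ x ◂_ ⟫ (leftMul ((y ∷ w) ∷ []) v) ≈ᴹ leftMul ((x ∷ y ∷ w) ∷ []) v
  ◂-leftMul x y w = ⟪⟫-∘ (x ◂_) (((y ∷ w) ∷ []) ++_)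

  -- The summand `H_u Φ_v` of a factorisation, with the words of `acc` following `v`; `tilde` drops
  -- a factor that is empty.
  factorTerm : Sentence → Word × Word → ∣NSym∣
  factorTerm acc (u , v) = leftMul (tilde (u ∷ [])) (Φ (tilde (v ∷ []) ++ acc))

  -- By the recursion for `Φʷ`, the term with empty prefix is `- X + B Y`, and the term with prefix
  -- `x` is `X`. What remains is the image under `x ◂_` of the whole sum for the shorter word, which
  -- vanishes by induction.
  ∑-factorisations : ∀ x w acc → ∑ NSym (factorisations (x ∷ w)) (factorTerm acc) ≈ᴹ N.0ᴹ
  ∑-factorisations x [] acc = begin
    leftMul [] (Φ ((x ∷ []) ∷ acc)) N.+ᴹ (leftMul ((x ∷ []) ∷ []) (Φ acc) N.+ᴹ N.0ᴹ)
      ≈⟨ N.+ᴹ-cong {leftMul [] (Φ ((x ∷ []) ∷ acc))} {Φ ((x ∷ []) ∷ acc)}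
           {leftMul ((x ∷ []) ∷ []) (Φ acc) N.+ᴹ N.0ᴹ} {leftMul ((x ∷ []) ∷ []) (Φ acc)}
           (leftMul-[] (Φ ((x ∷ []) ∷ acc))) (N.+ᴹ-identityʳ (leftMul ((x ∷ []) ∷ []) (Φ acc))) ⟩
    - 1# *ₗ ⟪ (x ∷ []) ∷_ ⟫ (Φ acc) N.+ᴹ ⟪ (x ∷ []) ∷_ ⟫ (Φ acc)
      ≈⟨ N.-ᴹ‿inverseˡ (⟪ (x ∷ []) ∷_ ⟫ (Φ acc)) ⟩
    N.0ᴹ ∎
    where
    open ≈-Reasoning N.≈ᴹ-setoid
  ∑-factorisations x (y ∷ w) acc = begin
    leftMul [] V N.+ᴹ (X N.+ᴹ T′)
      ≈⟨ N.+ᴹ-cong {leftMul [] V} {V} {X N.+ᴹ T′} {X N.+ᴹ B T}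
           (leftMul-[] V) (N.+ᴹ-congˡ {X} {T′} {B T} T′≈BT) ⟩
    (- 1# *ₗ X N.+ᴹ B Y) N.+ᴹ (X N.+ᴹ B T)
      ≈⟨ interchange (- 1# *ₗ X) (B Y) X (B T) ⟩
    (- 1# *ₗ X N.+ᴹ X) N.+ᴹ (B Y N.+ᴹ B T)
      ≈⟨ N.+ᴹ-congʳ {B Y N.+ᴹ B T} { - 1# *ₗ X N.+ᴹ X} {N.0ᴹ} (N.-ᴹ‿inverseˡ X) ⟩
    B Y N.+ᴹ B T
      ≈⟨ ⟪⟫.+ᴹ-homo (x ◂_) Y T ⟨
    B (Y N.+ᴹ T)
      ≈⟨ ⟪⟫-cong (x ◂_) (leftMul [] Y N.+ᴹ T) (Y N.+ᴹ T)
           (N.+ᴹ-congʳ {T} {leftMul [] Y} {Y} (leftMul-[] Y)) ⟨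
    B (leftMul [] Y N.+ᴹ T)
      ≈⟨ ⟪⟫-cong (x ◂_) (leftMul [] Y N.+ᴹ T) N.0ᴹ (∑-factorisations y w acc) ⟩
    B N.0ᴹ
      ≈⟨ ⟪⟫.0ᴹ-homo (x ◂_) ⟩
    N.0ᴹ ∎
    where
    open ≈-Reasoning N.≈ᴹ-setoid
    open CommutativeSemigroupProperties (CommutativeMonoid.commutativeSemigroup N.+ᴹ-commutativeMonoid)
      using (interchange)

    B : ∣NSym∣ → ∣NSym∣
    B = ⟪ x ◂_ ⟫

    t : Word × Word → ∣NSym∣
    t = factorTerm acc

    X Y V T T′ : ∣NSym∣
    X = ⟪ (x ∷ []) ∷_ ⟫ (Φ ((y ∷ w) ∷ acc))
    Y = Φ ((y ∷ w) ∷ acc)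
    V = - 1# *ₗ X N.+ᴹ B Y
    T = ∑ NSym (map (map₁ (y ∷_)) (factorisations w)) t
    T′ = ∑ NSym (map (map₁ (x ∷_)) (map (map₁ (y ∷_)) (factorisations w))) t

    T′≈BT : T′ ≈ᴹ B T
    T′≈BT = begin
      T′
        ≈⟨ ∑-map NSym (map₁ (x ∷_)) (map (map₁ (y ∷_)) (factorisations w)) t ⟩
      ∑ NSym (map (map₁ (y ∷_)) (factorisations w)) (t ∘ map₁ (x ∷_))
        ≈⟨ ∑-map NSym (map₁ (y ∷_)) (factorisations w) (t ∘ map₁ (x ∷_)) ⟩
      ∑ NSym (factorisations w) (t ∘ map₁ (x ∷_) ∘ map₁ (y ∷_))
        ≈⟨ ∑-cong NSym (factorisations w)
             (λ (u , v) → ◂-leftMul x y u (Φ (tilde (v ∷ []) ++ acc))) ⟨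
      ∑ NSym (factorisations w) (B ∘ t ∘ map₁ (y ∷_))
        ≈⟨ ⟪⟫.∑-homo (x ◂_) (factorisations w) (t ∘ map₁ (y ∷_)) ⟨
      B (∑ NSym (factorisations w) (t ∘ map₁ (y ∷_)))
        ≈⟨ ⟪⟫-cong (x ◂_) T (∑ NSym (factorisations w) (t ∘ map₁ (y ∷_)))
             (∑-map NSym (map₁ (y ∷_)) (factorisations w) t) ⟨
      B T ∎

  -- The accumulator lets the induction on I proceed without multiplicativity of Φ.

  splittingTerm : Sentence → List (Word × Word) → ∣NSym∣
  splittingTerm acc P = leftMul (tilde (map proj₁ P)) (Φ (tilde (map proj₂ P) ʳ++ acc))

  -- A factorisation `(u , v)` of the first word puts `u` outside as a left factor, and reversal
  -- moves `v` to the front of `acc`. The inner sum over `I` then vanishes by induction, or, for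
  -- empty `I`, the outer sum is that of `∑-factorisations`.
  ∑-splittings : ∀ w I acc → ∑ NSym (splittings (w ∷ I)) (splittingTerm acc) ≈ᴹ N.0ᴹ
  ∑-splittings w I acc = begin
    ∑ NSym (splittings (w ∷ I)) (splittingTerm acc)
      ≈⟨ ∑-cartesianProductWith NSym _∷_ (factorisations (toList w)) (splittings I) (splittingTerm acc) ⟩
    ∑ NSym (factorisations (toList w)) (λ uv → ∑ NSym (splittings I) (splittingTerm acc ∘ (uv ∷_)))
      ≈⟨ ∑-cong NSym (factorisations (toList w))
           {λ uv → ∑ NSym (splittings I) (splittingTerm acc ∘ (uv ∷_))} {term I} inner ⟩
    ∑ NSym (factorisations (toList w)) (term I)
      ≈⟨ outer I ⟩
    N.0ᴹ ∎
    where
    open ≈-Reasoning N.≈ᴹ-setoid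

    term : Sentence → Word × Word → ∣NSym∣
    term I (u , v) = leftMul (tilde (u ∷ [])) (∑ NSym (splittings I) (splittingTerm (tilde (v ∷ []) ++ acc)))

    inner : ∀ uv → ∑ NSym (splittings I) (splittingTerm acc ∘ (uv ∷_)) ≈ᴹ term I uv
    inner (u , v) = begin
      ∑ NSym (splittings I) (λ P → splittingTerm acc ((u , v) ∷ P))
        ≈⟨ ∑-cong NSym (splittings I) (λ P → N.≈ᴹ-reflexive (≡.cong₂ (λ K L → leftMul K (Φ L))
             (tilde-∷ u (map proj₁ P)) (tilde-ʳ++ v (map proj₂ P) acc))) ⟩
      ∑ NSym (splittings I) (λ P → leftMul (tilde (u ∷ []) ++ tilde (map proj₁ P))
        (Φ (tilde (map proj₂ P) ʳ++ (tilde (v ∷ []) ++ acc))))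
        ≈⟨ ∑-cong NSym (splittings I) (λ P → leftMul-++ (tilde (u ∷ [])) (tilde (map proj₁ P))
             (Φ (tilde (map proj₂ P) ʳ++ (tilde (v ∷ []) ++ acc)))) ⟩
      ∑ NSym (splittings I) (leftMul (tilde (u ∷ [])) ∘ splittingTerm (tilde (v ∷ []) ++ acc))
        ≈⟨ ⟪⟫.∑-homo (tilde (u ∷ []) ++_) (splittings I) (splittingTerm (tilde (v ∷ []) ++ acc)) ⟨
      leftMul (tilde (u ∷ [])) (∑ NSym (splittings I) (splittingTerm (tilde (v ∷ []) ++ acc))) ∎

    outer : ∀ I → ∑ NSym (factorisations (toList w)) (term I) ≈ᴹ N.0ᴹ
    outer [] = begin
      ∑ NSym (factorisations (toList w)) (term [])
        ≈⟨ ∑-cong NSym (factorisations (toList w)) {term []} {factorTerm acc} last ⟩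
      ∑ NSym (factorisations (toList w)) (factorTerm acc)
        ≈⟨ ∑-factorisations (List⁺.head w) (List⁺.tail w) acc ⟩
      N.0ᴹ ∎
      where
      last : ∀ uv → term [] uv ≈ᴹ factorTerm acc uv
      last (u , v) = ⟪⟫-cong (tilde (u ∷ []) ++_) (leftMul [] (Φ (tilde (v ∷ []) ++ acc)) N.+ᴹ N.0ᴹ)
          (Φ (tilde (v ∷ []) ++ acc)) (begin
        leftMul [] (Φ (tilde (v ∷ []) ++ acc)) N.+ᴹ N.0ᴹ   ≈⟨ N.+ᴹ-identityʳ (leftMul [] (Φ (tilde (v ∷ []) ++ acc))) ⟩
        leftMul [] (Φ (tilde (v ∷ []) ++ acc))             ≈⟨ leftMul-[] (Φ (tilde (v ∷ []) ++ acc)) ⟩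
        Φ (tilde (v ∷ []) ++ acc)                          ∎)
    outer (w′ ∷ I) = ∑-vanish NSym (factorisations (toList w)) {term (w′ ∷ I)} (λ {uv} _ → vanish uv)
      where
      vanish : ∀ uv → term (w′ ∷ I) uv ≈ᴹ N.0ᴹ
      vanish (u , v) = begin
        leftMul (tilde (u ∷ [])) (∑ NSym (splittings (w′ ∷ I)) (splittingTerm (tilde (v ∷ []) ++ acc)))
          ≈⟨ ⟪⟫-cong (tilde (u ∷ []) ++_) (∑ NSym (splittings (w′ ∷ I)) (splittingTerm (tilde (v ∷ []) ++ acc))) N.0ᴹ
               (∑-splittings w′ I (tilde (v ∷ []) ++ acc)) ⟩
        leftMul (tilde (u ∷ [])) N.0ᴹ
          ≈⟨ ⟪⟫.0ᴹ-homo (tilde (u ∷ []) ++_) ⟩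
        N.0ᴹ ∎

  -- The antipode on the basis `H`.

  module Convolution (S : ∣NSym∣ → ∣NSym∣) (isAntipode : IsAntipode S) where

    open IsAntipode isAntipode
    module S = Homomorphism NSym NSym linear

    id⊗S : Sentence × Sentence → ∣NSym⊗NSym∣
    id⊗S (I , J) = H I ⊗ S (H J)

    module id⊗S = Homomorphism NSym⊗NSym NSym⊗NSym
      (extend-linear (≡-dec _≟_ _≟_) NSym⊗NSym id⊗S)

    concatenate : Sentence × Sentence → ∣NSym∣
    concatenate (I , J) = H (I ++ J)

    module μ = Homomorphism NSym⊗NSym NSym
      (extend-linear (≡-dec _≟_ _≟_) NSym concatenate)

    μ-H⊗ : ∀ I v → μ (H I ⊗ v) ≈ᴹ leftMul I v
    μ-H⊗ I []            = N.≈ᴹ-refl {[]}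
    μ-H⊗ I ((k , J) ∷ v) = N.+ᴹ-cong {(1# * k) *ₗ H (I ++ J)} {k *ₗ H (I ++ J)} {μ (H I ⊗ v)} {leftMul I v}
      (N.*ₗ-congʳ {H (I ++ J)} (*-identityˡ k)) (μ-H⊗ I v)

    H⊗H : ∀ I J → (H I ⊗ H J) N⊗N.≈ᴹ basis (I , J)
    H⊗H I J = N⊗N.*ₗ-identityˡ (basis (I , J))

    term : List (Word × Word) → ∣NSym∣
    term P = leftMul (tilde (map proj₁ P)) (S (H (tilde (map proj₂ P))))

    convolution : ∀ I → μ ((id ⊗ₗ S) (Δ (H I))) ≈ᴹ ∑ NSym (splittings I) term
    convolution I = begin
      μ ((id ⊗ₗ S) (Δ (H I)))
        ≈⟨ μ.⟦⟧-cong {(id ⊗ₗ S) (Δ (H I))} {extend NSym⊗NSym id⊗S (∑ NSym⊗NSym (splittings I) split)}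
             (id⊗S.⟦⟧-cong {Δ (H I)} {∑ NSym⊗NSym (splittings I) split}
               (extend-basis NSym⊗NSym (λ J → ∑ NSym⊗NSym (splittings J) split) I)) ⟩
      μ (extend NSym⊗NSym id⊗S (∑ NSym⊗NSym (splittings I) split))
        ≈⟨ μ.⟦⟧-cong {extend NSym⊗NSym id⊗S (∑ NSym⊗NSym (splittings I) split)}
             {∑ NSym⊗NSym (splittings I) (extend NSym⊗NSym id⊗S ∘ split)}
             (id⊗S.∑-homo (splittings I) split) ⟩
      μ (∑ NSym⊗NSym (splittings I) (extend NSym⊗NSym id⊗S ∘ split))
        ≈⟨ μ.∑-homo (splittings I) (extend NSym⊗NSym id⊗S ∘ split) ⟩
      ∑ NSym (splittings I) (μ ∘ extend NSym⊗NSym id⊗S ∘ split)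
        ≈⟨ ∑-cong NSym (splittings I) {μ ∘ extend NSym⊗NSym id⊗S ∘ split} {term} split-term ⟩
      ∑ NSym (splittings I) term ∎
      where
      open ≈-Reasoning N.≈ᴹ-setoid

      split : List (Word × Word) → ∣NSym⊗NSym∣
      split P = H (tilde (map proj₁ P)) ⊗ H (tilde (map proj₂ P))

      split-term : ∀ P → μ (extend NSym⊗NSym id⊗S (split P)) ≈ᴹ term P
      split-term P = begin
        μ (extend NSym⊗NSym id⊗S (split P))
          ≈⟨ μ.⟦⟧-cong {extend NSym⊗NSym id⊗S (split P)} {id⊗S (K , L)} split≈ ⟩
        μ (H K ⊗ S (H L))
          ≈⟨ μ-H⊗ K (S (H L)) ⟩
        term P ∎
        where
        K L : Sentence
        K = tilde (map proj₁ P)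
        L = tilde (map proj₂ P)

        split≈ : extend NSym⊗NSym id⊗S (split P) N⊗N.≈ᴹ id⊗S (K , L)
        split≈ = N⊗N.≈ᴹ-trans
          {extend NSym⊗NSym id⊗S (split P)} {extend NSym⊗NSym id⊗S (basis (K , L))} {id⊗S (K , L)}
          (id⊗S.⟦⟧-cong {split P} {basis (K , L)} (H⊗H K L))
          (extend-basis NSym⊗NSym id⊗S (K , L))

    -- The counit kills `H` of a non-empty sentence. Together with `∑-splittings` this gives `S` and
    -- `Φ` after reversal the same recursion.
    ∑-term : ∀ w I → ∑ NSym (splittings (w ∷ I)) term ≈ᴹ N.0ᴹ
    ∑-term w I = begin
      ∑ NSym (splittings (w ∷ I)) term       ≈⟨ convolution (w ∷ I) ⟨
      μ ((id ⊗ₗ S) (Δ (H (w ∷ I))))          ≈⟨ inverseʳ (H (w ∷ I)) ⟩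
      ε (H (w ∷ I)) *ₗ H []                  ≈⟨ N.*ₗ-congʳ {H []} (extend-basis ground (δ _≟_ []) (w ∷ I)) ⟩
      0# *ₗ H []                             ≈⟨ N.*ₗ-zeroˡ (H []) ⟩
      N.0ᴹ                                   ∎
      where
      open ≈-Reasoning N.≈ᴹ-setoid

    S-H-[] : S (H []) ≈ᴹ H []
    S-H-[] = begin
      S (H [])                               ≈⟨ leftMul-[] (S (H [])) ⟨
      leftMul [] (S (H []))                  ≈⟨ N.+ᴹ-identityʳ (leftMul [] (S (H []))) ⟨
      ∑ NSym (splittings []) term            ≈⟨ convolution [] ⟨
      μ ((id ⊗ₗ S) (Δ (H [])))               ≈⟨ inverseʳ (H []) ⟩
      ε (H []) *ₗ H []                       ≈⟨ N.*ₗ-congʳ {H []} (extend-basis ground (δ _≟_ []) []) ⟩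
      1# *ₗ H []                             ≈⟨ N.*ₗ-identityˡ (H []) ⟩
      H []                                   ∎
      where
      open ≈-Reasoning N.≈ᴹ-setoid

    -- The sums of `term` and of `splittingTerm []` over all splittings are both zero. By induction
    -- they agree on all splittings but the full one, so they agree there too. The bound `n` serves
    -- the induction on the number of letters.
    S-H : ∀ n I → ∣ I ∣ < n → S (H I) ≈ᴹ Φ (reverse I)
    S-H n       []      _           = S-H-[]
    S-H (suc n) (w ∷ I) (s≤s ∣wI∣≤n) = begin
      S (H (w ∷ I))                          ≈⟨ leftMul-[] (S (H (w ∷ I))) ⟨
      leftMul [] (S (H (w ∷ I)))
        ≡⟨ ≡.cong₂ (λ K L → leftMul K (S (H L)))
             (tilde-fullSplitting₁ (w ∷ I)) (tilde-fullSplitting₂ (w ∷ I)) ⟨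
      term full                              ≈⟨ cancelled ⟩
      splittingTerm [] full
        ≡⟨ ≡.cong₂ (λ K L → leftMul K (Φ (reverse L)))
             (tilde-fullSplitting₁ (w ∷ I)) (tilde-fullSplitting₂ (w ∷ I)) ⟩
      leftMul [] (Φ (reverse (w ∷ I)))       ≈⟨ leftMul-[] (Φ (reverse (w ∷ I))) ⟩
      Φ (reverse (w ∷ I))                    ∎
      where
      open ≈-Reasoning N.≈ᴹ-setoid
      open FullSplittingFirst (fullSplitting-first (w ∷ I))

      full : List (Word × Word)
      full = fullSplitting (w ∷ I)

      others≈ : ∑ NSym others term ≈ᴹ ∑ NSym others (splittingTerm [])
      others≈ = ∑-cong-∈ NSym others {term} {splittingTerm []} λ {P} P∈ →
        ⟪⟫-cong (tilde (map proj₁ P) ++_) (S (H (tilde (map proj₂ P)))) (Φ (reverse (tilde (map proj₂ P))))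
          (S-H n (tilde (map proj₂ P)) (ℕₚ.<-≤-trans
            (≡.subst (_< ∣ w ∷ I ∣) (≡.cong length (≡.sym (maximalWord-tilde (map proj₂ P)))) (shorter P∈))
            ∣wI∣≤n))

      cancelled : term full ≈ᴹ splittingTerm [] full
      cancelled = GroupProperties.∙-cancelʳ N.+ᴹ-group (∑ NSym others term) (term full) (splittingTerm [] full) (begin
        ∑ NSym (full ∷ others) term
          ≡⟨ ≡.cong (λ Ps → ∑ NSym Ps term) first ⟨
        ∑ NSym (splittings (w ∷ I)) term
          ≈⟨ ∑-term w I ⟩
        N.0ᴹ
          ≈⟨ ∑-splittings w I [] ⟨
        ∑ NSym (splittings (w ∷ I)) (splittingTerm [])
          ≡⟨ ≡.cong (λ Ps → ∑ NSym Ps (splittingTerm [])) first ⟩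
        splittingTerm [] full N.+ᴹ ∑ NSym others (splittingTerm [])
          ≈⟨ N.+ᴹ-congˡ {splittingTerm [] full} {∑ NSym others term} {∑ NSym others (splittingTerm [])} others≈ ⟨
        splittingTerm [] full N.+ᴹ ∑ NSym others term ∎)

    S∘r : ∀ v → S (r v) ≈ᴹ extend NSym Φ v
    S∘r v = begin
      S (r v)                                ≈⟨ S.extend-homo (H ∘ reverse) v ⟩
      extend NSym (S ∘ H ∘ reverse) v        ≈⟨ extend-congᶠ NSym {f = S ∘ H ∘ reverse} {Φ} S-H-reverse v ⟩
      extend NSym Φ v                        ∎
      where
      open ≈-Reasoning N.≈ᴹ-setoid

      S-H-reverse : ∀ I → S (H (reverse I)) ≈ᴹ Φ I
      S-H-reverse I = begin
        S (H (reverse I))                    ≈⟨ S-H _ (reverse I) ℕₚ.≤-refl ⟩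
        Φ (reverse (reverse I))              ≡⟨ ≡.cong Φ (reverse-involutive I) ⟩
        Φ I                                  ∎

  -- Recovering a combination from its pairings with the fundamental functions.

  refinement-sums-determine : ∀ {J} → Letterwise J → (f g : Sentence → Carrier) →
    (∀ J → ∑ ground (refinements J) f ≈ ∑ ground (refinements J) g) → f J ≈ g J
  refinement-sums-determine empty f g f≈g =
    trans (sym (+-identityʳ _)) (trans (f≈g []) (+-identityʳ _))
  -- All refinements of `(x ∷ []) ∷ J` begin with the word `x`, so the hypothesis restricts to
  -- sentences of that form.
  refinement-sums-determine (single x view) f g f≈g =
    refinement-sums-determine view (f ∘ ((x ∷ []) ∷_)) (g ∘ ((x ∷ []) ∷_)) λ J →
      trans (sym (∑-map ground ((x ∷ []) ∷_) (refinements J) f))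
        (trans (f≈g ((x ∷ []) ∷ J)) (∑-map ground ((x ∷ []) ∷_) (refinements J) g))
  refinement-sums-determine (attach x view) f g f≈g =
    refinement-sums-determine view (f ∘ (x ◂_)) (g ∘ (x ◂_)) attached
    where
    open ≈-Reasoning setoid

    attached : ∀ J → ∑ ground (refinements J) (f ∘ (x ◂_)) ≈ ∑ ground (refinements J) (g ∘ (x ◂_))
    attached []      = f≈g ((x ∷ []) ∷ [])
    attached (w ∷ J) = begin
      ∑ ground Ks (f ∘ (x ◂_))             ≈⟨ ∑-map ground (x ◂_) Ks f ⟨
      -- Subtracting the hypothesis for the sentence that separates `x` from the one for the
      -- sentence that attaches it leaves the refinements attaching `x`.
      ∑ ground (map (x ◂_) Ks) f           ≈⟨ +-cancelˡ (∑ ground (map ((x ∷ []) ∷_) Ks) f) _ _ (begin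
        ∑ ground (map ((x ∷ []) ∷_) Ks) f + ∑ ground (map (x ◂_) Ks) f
          ≈⟨ ∑-++ ground (map ((x ∷ []) ∷_) Ks) (map (x ◂_) Ks) f ⟨
        ∑ ground (refinements (x ◂ (w ∷ J))) f
          ≈⟨ f≈g (x ◂ (w ∷ J)) ⟩
        ∑ ground (refinements (x ◂ (w ∷ J))) g
          ≈⟨ ∑-++ ground (map ((x ∷ []) ∷_) Ks) (map (x ◂_) Ks) g ⟩
        ∑ ground (map ((x ∷ []) ∷_) Ks) g + ∑ ground (map (x ◂_) Ks) g
          ≈⟨ +-congʳ (f≈g ((x ∷ []) ∷ w ∷ J)) ⟨
        ∑ ground (map ((x ∷ []) ∷_) Ks) f + ∑ ground (map (x ◂_) Ks) g ∎) ⟩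
      ∑ ground (map (x ◂_) Ks) g           ≈⟨ ∑-map ground (x ◂_) Ks g ⟩
      ∑ ground Ks (g ∘ (x ◂_))             ∎
      where
      Ks : List Sentence
      Ks = refinements (w ∷ J)

  -- The coefficients of `v`, summed over the refinements of `J`, give `E J v`; hence these values
  -- determine every coefficient.
  E-separates : ∀ v w → (∀ J → E J v ≈ E J w) → v ≈ᴹ w
  E-separates v w E≈ K = refinement-sums-determine (letterwise K)
    (λ K → coefficient _≟_ K v) (λ K → coefficient _≟_ K w)
    λ J → trans (∑-extend ground (refinements J) (δ _≟_) v)
      (trans (E≈ J) (sym (∑-extend ground (refinements J) (δ _≟_) w)))

  ⟨F,⟩≈E : ∀ J v → ⟨ F J , v ⟩ ≈ E J v
  ⟨F,⟩≈E J v = begin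
    ⟨ F J , v ⟩
      ≈⟨ Homomorphism.∑-homo QSym ground (extend-linear _≟_ ground v-pairing) (refinements J) M ⟩
    ∑ ground (refinements J) (extend ground v-pairing ∘ M)
      ≈⟨ ∑-cong ground (refinements J) (extend-basis ground v-pairing) ⟩
    ∑ ground (refinements J) v-pairing
      ≈⟨ ∑-extend ground (refinements J) (δ _≟_) v ⟩
    E J v ∎
    where
    open ≈-Reasoning setoid

    v-pairing : Sentence → Carrier
    v-pairing K = extend ground (δ _≟_ K) v

  -- Combined with `S∘r`, this is the dual form of the theorem: the adjoint of `S ∘ r` sends `F J`
  -- to `F (J ᶜ)` with the sign of `∣ J ∣`.
  E-extend-Φ : ∀ J v → E J (extend NSym Φ v) ≈ sign ∣ J ∣ * E (J ᶜ) v
  E-extend-Φ J v = begin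
    E J (extend NSym Φ v)
      ≈⟨ E.extend-homo J Φ v ⟩
    extend ground (E J ∘ Φ) v
      ≈⟨ extend-congᶠ ground (λ I → E-Φ (letterwise J) (letterwise I)) v ⟩
    extend ground (λ I → sign ∣ J ∣ * e (J ᶜ) I) v
      ≈⟨ extend-*ₗ ground (sign ∣ J ∣) (e (J ᶜ)) v ⟩
    sign ∣ J ∣ * E (J ᶜ) v ∎
    where
    open ≈-Reasoning setoid

  -- Complementation is an involution that preserves the number of letters.
  sign-δ-ᶜ : ∀ I J → sign ∣ J ∣ * δ _≟_ (J ᶜ) I ≈ sign ∣ I ∣ * δ _≟_ J (I ᶜ)
  sign-δ-ᶜ I J with J ≟ I ᶜ
  ... | yes ≡.refl = *-cong (reflexive (≡.cong sign (∣ᶜ∣ I)))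
    (reflexive (δ-≡ _≟_ (I ᶜ ᶜ) I (ᶜ-involutive I)))
  ... | no  J≢Iᶜ   = trans
    (trans (*-congˡ (reflexive (δ-≢ _≟_ (J ᶜ) I (λ Jᶜ≡I →
      J≢Iᶜ (≡.trans (≡.sym (ᶜ-involutive J)) (≡.cong _ᶜ Jᶜ≡I)))))) (zeroʳ _))
    (sym (zeroʳ _))

corollary5p8 : {c ℓ₁ ℓ₂ a : Level} (𝕜 : HeytingField c ℓ₁ ℓ₂) → Field.CharacteristicZero 𝕜 →
    (A : Set a) (n : ℕ) (finite : A ↔ Fin n) →
    let open Symmetric 𝕜 finite in
    (S : ∣NSym∣ → ∣NSym∣) → IsAntipode S →
    (R : Sentence → ∣NSym∣) → IsDualToF R →
    (I : Sentence) → S (r (R I)) ≈ᴹ sign ∣ I ∣ *ₗ R (I ᶜ)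
corollary5p8 𝕜 _ A n finite S isAntipode R isDual I =
  E-separates (S (r (R I))) (sign ∣ I ∣ *ₗ R (I ᶜ)) λ J → begin
    E J (S (r (R I)))
      ≈⟨ E.⟦⟧-cong J {S (r (R I))} {extend NSym Φ (R I)} (S∘r (R I)) ⟩
    E J (extend NSym Φ (R I))
      ≈⟨ E-extend-Φ J (R I) ⟩
    sign ∣ J ∣ * E (J ᶜ) (R I)
      ≈⟨ *-congˡ (E-R (J ᶜ) I) ⟩
    sign ∣ J ∣ * δ _≟_ (J ᶜ) I
      ≈⟨ sign-δ-ᶜ I J ⟩
    sign ∣ I ∣ * δ _≟_ J (I ᶜ)
      ≈⟨ *-congˡ (E-R J (I ᶜ)) ⟨
    sign ∣ I ∣ * E J (R (I ᶜ))
      ≈⟨ E.*ₗ-homo J (sign ∣ I ∣) (R (I ᶜ)) ⟨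
    E J (sign ∣ I ∣ *ₗ R (I ᶜ)) ∎
  where
  open Symmetric 𝕜 finite
  open CommutativeRing ring hiding (ring)
  open Ribbons 𝕜 finite
  open Convolution S isAntipode using (S∘r)
  open ≈-Reasoning setoid

  E-R : ∀ J K → E J (R K) ≈ δ _≟_ J K
  E-R J K = trans (sym (⟨F,⟩≈E J (R K))) (isDual J K)
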